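{- Let $m$ be an odd squarefree positive integer. Let $A\subset\mathbb{Z}_m^*$ be a subset with $|A|>\tfrac{5}{8}\phi(m)$. Then $A+A+A=\mathbb{Z}_m$.
   Context: $\mathbb{Z}_m=\mathbb{Z}/m\mathbb{Z}$, $\mathbb{Z}_m^*$ is the set of reduced residues (units) modulo $m$, and $\phi(m)=|\mathbb{Z}_m^*|$ is Euler's totient function. $A+A+A=\{a_1+a_2+a_3:a_1,a_2,a_3\in A\}$. -}

module Defs where

open import Data.Fin.Base using (Fin; toℕ)
open import Data.Fin.Subset using (Subset; _∈_; ∣_∣)
open import Data.Nat.Base using (ℕ; NonZero; _+_; _*_)
open import Data.Nat.Coprimality using (coprime?)
open import Data.Nat.Divisibility using (_∣_; _∤_)
open import Data.Nat.DivMod using (_mod_)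
open import Data.Product.Base using (∃-syntax; _×_)
open import Data.Vec.Base using (tabulate)
open import Level using (0ℓ)
open import Relation.Binary.PropositionalEquality.Core using (_≡_)
open import Relation.Nullary.Decidable.Core using (does)
open import Relation.Unary using (Pred)

Odd : ℕ → Set
Odd m = 2 ∤ m

SquareFree : ℕ → Set
SquareFree m = ∀ d → d * d ∣ m → d ≡ 1

-- ℤ/mℤ is represented by the least nonnegative residues, so that propositional
-- equality on ℤ/ m is congruence modulo m.
ℤ/_ : ℕ → Set
ℤ/ m = Fin m

module _ {m : ℕ} .{{_ : NonZero m}} where

  infixl 6 _⊕_

  _⊕_ : ℤ/ m → ℤ/ m → ℤ/ m
  a ⊕ b = (toℕ a + toℕ b) mod m

  -- A + B + C as a set of residues; the summands need not be distinct.
  TripleSum : Subset m → Subset m → Subset m → Pred (ℤ/ m) 0ℓ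
  TripleSum A B C x =
    ∃[ a ] ∃[ b ] ∃[ c ] a ∈ A × b ∈ B × c ∈ C × x ≡ a ⊕ b ⊕ c

-- The residues coprime to m.  For m = 1 this is {0}, hence φ 1 ≡ 1.
units : (m : ℕ) → Subset m
units m = tabulate λ a → does (coprime? (toℕ a) m)

φ : ℕ → ℕ
φ m = ∣ units m ∣

{-# OPTIONS --safe #-}
module Submission where

-- Let m be coprime to 30.  If A, B, C are sets of units with A + B + C ≠ ℤ/m, then their
-- densities satisfy c (1 - d) ≤ ε d, where d = (1 - a) + (1 - b) and 1 + ε is the product of
-- 1 + 1/((p - 1)(p - 2)) over the primes p dividing m.  This follows by removing one prime p at a
-- time: let t₀ be the residue mod p whose fibre of C is largest.  For any other residue t₁, the
-- graph on two copies of ℤ/p joining r to s when r + s + t₀ or r + s + t₁ is the target residue is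
-- a single cycle, and deleting the vertices 0 leaves a perfect matching of the units; averaging
-- over it loses nothing.  Only the fibre over t₀ itself suffers a loss.
-- Since ε ≤ 1/12, the primes 5 and 3 can then be handled by hand: for m coprime to 6 one gets
-- a + c ≤ 5/4 whenever A + A + C ≠ ℤ/m, and taking fibres mod 3 turns this into a ≤ 5/8.

open import Defs
open import Data.Nat.Base using (ℕ; NonZero; _*_; _>_)
open import Data.Fin.Subset using (Subset; _⊆_; ∣_∣)
open import Relation.Unary using (_≐_; U)

open import Data.Bool.Base using (Bool; true; false; not; _∧_; if_then_else_)
open import Data.Bool.Properties using (∧-identityʳ; ∧-zeroʳ)
open import Data.Empty using (⊥)
open import Data.Fin.Base using (Fin; toℕ)
open import Data.Fin.Permutation using (Permutation′; permutation)
open import Data.Fin.Properties using (toℕ<n; toℕ-injective; toℕ-fromℕ<; any?) renaming (_≟_ to _≟ᶠ_)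
open import Data.Fin.Subset.Properties using (_∈?_)
open import Data.Nat.Base hiding (compare)
open import Data.Nat.Coprimality as Coprime using (Coprime; coprime?; coprime-divisor; coprime-Bézout)
open import Data.Nat.DivMod
  using (_%_; _/_; _mod_; m≡m%n+[m/n]*n; [m+kn]%n≡m%n; m<n⇒m%n≡m; m%n<n)
open import Data.Nat.Divisibility
open import Data.Nat.GCD using (module Bézout)
open import Data.Nat.Primality
open import Data.Nat.Properties
open import Data.Nat.Tactic.RingSolver using (solve-∀)
open import Data.Product.Base using (∃; ∃₂; _×_; _,_; proj₁; proj₂)
open import Data.Sum.Base using (_⊎_; inj₁; inj₂)
open import Data.Unit.Base using (tt)
open import Data.Vec.Base using (lookup; tabulate)
open import Data.Vec.Properties using (lookup∘tabulate; tabulate∘lookup; tabulate-cong; []=⇒lookup; lookup⇒[]=)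
open import Function.Base using (_∘_; const)
open import Function.Bundles using (_⇔_; mk⇔; module Equivalence)
open import Relation.Binary.PropositionalEquality
open import Relation.Nullary using (¬_; Dec; yes; no; does; contradiction)
open import Relation.Nullary.Decidable using (from-yes; decidable-stable; does-⇔; dec-false; _×-dec_)
open import Algebra.Properties.CommutativeSemigroup +-commutativeSemigroup using (interchange)
open import Algebra.Properties.Semiring.Sum +-*-semiring using (sum; sum-permute; sum-cong-≗)

-- Finite sums and congruences

∑ : ℕ → (ℕ → ℕ) → ℕ
∑ zero    f = 0
∑ (suc n) f = f 0 + ∑ n (f ∘ suc)

∑≡sum : ∀ n (f : ℕ → ℕ) → ∑ n f ≡ sum {n} (f ∘ toℕ)
∑≡sum zero    f = refl
∑≡sum (suc n) f = cong (f 0 +_) (∑≡sum n (f ∘ suc))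

∑-cong-< : ∀ n {f g : ℕ → ℕ} → (∀ i → i < n → f i ≡ g i) → ∑ n f ≡ ∑ n g
∑-cong-< zero    f≡g = refl
∑-cong-< (suc n) f≡g = cong₂ _+_ (f≡g 0 z<s) (∑-cong-< n λ i i<n → f≡g (suc i) (s<s i<n))

∑-cong : ∀ n {f g : ℕ → ℕ} → (∀ i → f i ≡ g i) → ∑ n f ≡ ∑ n g
∑-cong n f≡g = ∑-cong-< n λ i _ → f≡g i

∑-mono-< : ∀ n {f g : ℕ → ℕ} → (∀ i → i < n → f i ≤ g i) → ∑ n f ≤ ∑ n g
∑-mono-< zero    f≤g = z≤n
∑-mono-< (suc n) f≤g = +-mono-≤ (f≤g 0 z<s) (∑-mono-< n λ i i<n → f≤g (suc i) (s<s i<n))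

∑-+ : ∀ n (f g : ℕ → ℕ) → ∑ n (λ i → f i + g i) ≡ ∑ n f + ∑ n g
∑-+ zero    f g = refl
∑-+ (suc n) f g = trans (cong (f 0 + g 0 +_) (∑-+ n (f ∘ suc) (g ∘ suc)))
                        (interchange (f 0) (g 0) _ _)

∑-*ˡ : ∀ n c (f : ℕ → ℕ) → ∑ n (λ i → c * f i) ≡ c * ∑ n f
∑-*ˡ zero    c f = sym (*-zeroʳ c)
∑-*ˡ (suc n) c f = trans (cong (c * f 0 +_) (∑-*ˡ n c (f ∘ suc))) (sym (*-distribˡ-+ c (f 0) _))

∑-const : ∀ n c → ∑ n (λ _ → c) ≡ n * c
∑-const zero    c = refl
∑-const (suc n) c = cong (c +_) (∑-const n c)

∑-comm : ∀ m n (f : ℕ → ℕ → ℕ) → ∑ m (λ i → ∑ n (f i)) ≡ ∑ n (λ j → ∑ m λ i → f i j)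
∑-comm zero    n f = sym (trans (∑-const n 0) (*-zeroʳ n))
∑-comm (suc m) n f = trans (cong (∑ n (f 0) +_) (∑-comm m n (f ∘ suc))) (sym (∑-+ n (f 0) _))

∑-++ : ∀ m n (f : ℕ → ℕ) → ∑ (m + n) f ≡ ∑ m f + ∑ n (λ i → f (m + i))
∑-++ zero    n f = refl
∑-++ (suc m) n f = trans (cong (f 0 +_) (∑-++ m n (f ∘ suc))) (sym (+-assoc (f 0) _ _))

∑-last : ∀ n (f : ℕ → ℕ) → ∑ (suc n) f ≡ ∑ n f + f n
∑-last zero    f = +-comm (f 0) 0
∑-last (suc n) f = trans (cong (f 0 +_) (∑-last n (f ∘ suc))) (sym (+-assoc (f 0) _ _))

∑-reverse : ∀ n (f : ℕ → ℕ) → ∑ n (λ i → f (n ∸ suc i)) ≡ ∑ n f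
∑-reverse zero    f = refl
∑-reverse (suc n) f = begin
  f n + ∑ n (λ i → f (n ∸ suc i)) ≡⟨ cong (f n +_) (∑-reverse n f) ⟩
  f n + ∑ n f                     ≡⟨ +-comm (f n) _ ⟩
  ∑ n f + f n                     ≡⟨ ∑-last n f ⟨
  ∑ (suc n) f                     ∎
  where open ≡-Reasoning

∑-blocks : ∀ m n (f : ℕ → ℕ) → ∑ (m * n) f ≡ ∑ m (λ i → ∑ n λ j → f (i * n + j))
∑-blocks zero    n f = refl
∑-blocks (suc m) n f = trans (∑-++ n (m * n) f) (cong (∑ n f +_)
  (trans (∑-blocks m n (λ i → f (n + i)))
         (∑-cong m λ i → ∑-cong n λ j → cong f (sym (+-assoc n (i * n) j)))))

infix 4 _≋_[_]

-- Multiples of `m` are allowed on both sides because ℕ has no subtraction; below, negation modulo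
-- `suc n` is written as multiplication by `n`.
_≋_[_] : ℕ → ℕ → ℕ → Set
a ≋ b [ m ] = ∃₂ λ k l → a + k * m ≡ b + l * m

module _ {m : ℕ} where

  ≋-refl : ∀ {a} → a ≋ a [ m ]
  ≋-refl = 0 , 0 , refl

  ≋-reflexive : ∀ {a b} → a ≡ b → a ≋ b [ m ]
  ≋-reflexive refl = ≋-refl

  ≋-sym : ∀ {a b} → a ≋ b [ m ] → b ≋ a [ m ]
  ≋-sym (k , l , eq) = l , k , sym eq

  ≋-trans : ∀ {a b c} → a ≋ b [ m ] → b ≋ c [ m ] → a ≋ c [ m ]
  ≋-trans {a} {b} {c} (k , l , eq) (k′ , l′ , eq′) = k + k′ , l + l′ , (begin
    a + (k + k′) * m       ≡⟨ shuffle a k k′ m ⟩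
    a + k * m + k′ * m     ≡⟨ cong (_+ k′ * m) eq ⟩
    b + l * m + k′ * m     ≡⟨ swap′ b l k′ m ⟩
    b + k′ * m + l * m     ≡⟨ cong (_+ l * m) eq′ ⟩
    c + l′ * m + l * m     ≡⟨ unshuffle c l l′ m ⟩
    c + (l + l′) * m       ∎)
    where
    open ≡-Reasoning
    shuffle : ∀ a k k′ m → a + (k + k′) * m ≡ a + k * m + k′ * m
    shuffle = solve-∀
    swap′ : ∀ b l k m → b + l * m + k * m ≡ b + k * m + l * m
    swap′ = solve-∀
    unshuffle : ∀ c l l′ m → c + l′ * m + l * m ≡ c + (l + l′) * m
    unshuffle = solve-∀

  ≋-+ : ∀ {a b c d} → a ≋ b [ m ] → c ≋ d [ m ] → a + c ≋ b + d [ m ]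
  ≋-+ {a} {b} {c} {d} (k , l , eq) (k′ , l′ , eq′) = k + k′ , l + l′ ,
    trans (regroup a c k k′ m) (trans (cong₂ _+_ eq eq′) (sym (regroup b d l l′ m)))
    where
    regroup : ∀ a c k k′ m → a + c + (k + k′) * m ≡ a + k * m + (c + k′ * m)
    regroup = solve-∀

  ≋-suc⁻¹ : ∀ {a b} → suc a ≋ suc b [ m ] → a ≋ b [ m ]
  ≋-suc⁻¹ (k , l , eq) = k , l , suc-injective eq

  ≋-*ˡ : ∀ c {a b} → a ≋ b [ m ] → c * a ≋ c * b [ m ]
  ≋-*ˡ c {a} {b} (k , l , eq) = c * k , c * l ,
    trans (factor c a k m) (trans (cong (c *_) eq) (sym (factor c b l m)))
    where
    factor : ∀ c a k m → c * a + c * k * m ≡ c * (a + k * m)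
    factor = solve-∀

  ≋-+-multiple : ∀ a k → a + k * m ≋ a [ m ]
  ≋-+-multiple a k = 0 , k , +-identityʳ _

  ≋-% : ∀ a .{{_ : NonZero m}} → a % m ≋ a [ m ]
  ≋-% a = a / m , 0 , trans (sym (m≡m%n+[m/n]*n a m)) (sym (+-identityʳ a))

  ≋⇒%≡ : ∀ {a b} .{{_ : NonZero m}} → a ≋ b [ m ] → a % m ≡ b % m
  ≋⇒%≡ {a} {b} (k , l , eq) =
    trans (sym ([m+kn]%n≡m%n a k m)) (trans (cong (_% m) eq) ([m+kn]%n≡m%n b l m))

  ≋-<⇒≡ : ∀ {a b} → a ≋ b [ m ] → a < m → b < m → a ≡ b
  ≋-<⇒≡ {a} {b} a≋b a<m b<m =
    trans (sym (m<n⇒m%n≡m a<m)) (trans (≋⇒%≡ a≋b) (m<n⇒m%n≡m b<m))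
    where instance _ = >-nonZero (<-≤-trans z<s a<m)

  ∣-resp-≋ : ∀ {a b d} → d ∣ m → a ≋ b [ m ] → d ∣ a → d ∣ b
  ∣-resp-≋ {a} {b} {d} d∣m (k , l , eq) d∣a =
    ∣m+n∣m⇒∣n (subst (d ∣_) (trans eq (+-comm b _)) (∣m∣n⇒∣m+n d∣a (∣n⇒∣m*n k d∣m))) (∣n⇒∣m*n l d∣m)

-- Functions on ℤ/m are carried as periodic functions on ℕ, so that residues such as `p * i + m * j`
-- can be formed without reduction.
Periodic : {X : Set} → ℕ → (ℕ → X) → Set
Periodic m f = ∀ a → f (a + m) ≡ f a

module _ {X : Set} {m : ℕ} {f : ℕ → X} (f-per : Periodic m f) where

  periodic-* : ∀ k a → f (a + k * m) ≡ f a
  periodic-* zero    a = cong f (+-identityʳ a)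
  periodic-* (suc k) a = trans (cong f (sym (+-assoc a m (k * m)))) (trans (periodic-* k (a + m)) (f-per a))

  periodic-≋ : ∀ {a b} → a ≋ b [ m ] → f a ≡ f b
  periodic-≋ {a} {b} (k , l , eq) =
    trans (sym (periodic-* k a)) (trans (cong f eq) (periodic-* l b))

inverse-mod : ∀ {u p} → Coprime u p → .{{_ : NonZero p}} → ∃ λ v → v * u ≋ 1 [ p ]
inverse-mod {u} {p} c with coprime-Bézout c
... | Bézout.+- x y eq = x , 0 , y , trans (+-identityʳ _) (sym eq)
-- In this case `1 + x * u = y * p`, so the inverse is -x, represented by `pred p * x`.
... | Bézout.-+ x y eq = pred p * x , y , x * u , (begin
    pred p * x * u + y * p           ≡⟨ cong (pred p * x * u +_) eq ⟨
    pred p * x * u + (1 + x * u)     ≡⟨ collect (pred p) x u ⟩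
    1 + x * u * suc (pred p)         ≡⟨ cong (λ q → 1 + x * u * q) (suc-pred p) ⟩
    1 + x * u * p                    ∎)
    where
    open ≡-Reasoning
    collect : ∀ q x u → q * x * u + (1 + x * u) ≡ 1 + x * u * suc q
    collect = solve-∀

module _ {p : ℕ} .{{_ : NonZero p}} where

  toℕ-mod : ∀ a → toℕ (a mod p) ≋ a [ p ]
  toℕ-mod a = ≋-trans (≋-reflexive (toℕ-fromℕ< (m%n<n a p))) (≋-% a)

  scale : ℕ → Fin p → Fin p
  scale u i = (u * toℕ i) mod p

  scale-inverse : ∀ {u v} → v * u ≋ 1 [ p ] → ∀ i → scale v (scale u i) ≡ i
  scale-inverse {u} {v} vu≋1 i = toℕ-injective (≋-<⇒≡ v[ui]≋i (toℕ<n _) (toℕ<n i))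
    where
    v[ui]≋i : toℕ (scale v (scale u i)) ≋ toℕ i [ p ]
    v[ui]≋i = ≋-trans (toℕ-mod _) (≋-trans (≋-*ˡ v (toℕ-mod _))
      (≋-trans (≋-reflexive (trans (sym (*-assoc v u _)) (*-comm (v * u) (toℕ i))))
      (≋-trans (≋-*ˡ (toℕ i) vu≋1) (≋-reflexive (*-identityʳ _)))))

  ∑-scale : ∀ {u} → Coprime u p → ∀ {f} → Periodic p f → ∑ p (λ i → f (u * i)) ≡ ∑ p f
  ∑-scale {u} c {f} f-per = begin
    ∑ p (λ i → f (u * i))              ≡⟨ ∑≡sum p _ ⟩
    sum {p} (λ i → f (u * toℕ i))          ≡⟨ sum-cong-≗ {p} (λ i → periodic-≋ f-per (toℕ-mod (u * toℕ i))) ⟨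
    sum {p} (λ i → f (toℕ (scale u i)))    ≡⟨ sum-permute (f ∘ toℕ) π ⟨
    sum {p} (f ∘ toℕ)                  ≡⟨ ∑≡sum p f ⟨
    ∑ p f                              ∎
    where
    open ≡-Reasoning
    v = proj₁ (inverse-mod c)
    vu≋1 = proj₂ (inverse-mod c)
    π : Permutation′ p
    π = permutation (scale u) (scale v)
      (scale-inverse {v} {u} (≋-trans (≋-reflexive (*-comm u v)) vu≋1)) (scale-inverse {u} {v} vu≋1)

∑-shift : ∀ m {f} → Periodic m f → ∑ m (f ∘ suc) ≡ ∑ m f
∑-shift m {f} f-per = +-cancelˡ-≡ (f 0) _ _
  (trans (∑-last m f) (trans (+-comm _ (f m)) (cong (_+ ∑ m f) (f-per 0))))

-- Grouping by the class modulo `p` gives inner sums `G j` that depend on `j` only modulo `p`. As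
-- `m` is a unit there, `j` may be replaced by `m * j`.
∑-crt : ∀ p m .{{_ : NonZero p}} → Coprime m p → ∀ {f} → Periodic (p * m) f →
        ∑ (p * m) f ≡ ∑ p λ j → ∑ m λ i → f (p * i + m * j)
∑-crt p m c {f} f-per = begin
  ∑ (p * m) f                              ≡⟨ cong (λ k → ∑ k f) (*-comm p m) ⟩
  ∑ (m * p) f                              ≡⟨ ∑-blocks m p f ⟩
  ∑ m (λ i → ∑ p λ j → f (i * p + j))      ≡⟨ ∑-comm m p _ ⟩
  ∑ p G                                    ≡⟨ ∑-scale c G-per ⟨
  ∑ p (λ j → G (m * j))                    ≡⟨ ∑-cong p (λ j → ∑-cong m λ i → cong (λ k → f (k + m * j)) (*-comm i p)) ⟩
  ∑ p (λ j → ∑ m λ i → f (p * i + m * j))  ∎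
  where
  open ≡-Reasoning
  G : ℕ → ℕ
  G j = ∑ m λ i → f (i * p + j)
  row : ∀ i m j → (i + m) * p + j ≡ i * p + j + p * m
  row i m j = solve-row i m j p
    where
    solve-row : ∀ i m j p → (i + m) * p + j ≡ i * p + j + p * m
    solve-row = solve-∀
  carry : ∀ i j → i * p + (j + p) ≡ suc i * p + j
  carry i j = solve-carry i j p
    where
    solve-carry : ∀ i j p → i * p + (j + p) ≡ suc i * p + j
    solve-carry = solve-∀
  G-per : Periodic p G
  G-per j = trans (∑-cong m λ i → cong f (carry i j))
    (∑-shift m {λ i → f (i * p + j)} λ i → trans (cong f (row i m j)) (f-per _))

-- Pairing the units modulo a prime

-- This compares the two sums with their terms at `k` deleted; each deleted term is added on the
-- opposite side in place of a subtraction.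
∑-except : ∀ n {f g : ℕ → ℕ} k → k < n → (∀ i → i < n → i ≢ k → f i ≤ g i) →
           ∑ n f + g k ≤ ∑ n g + f k
∑-except (suc n) {f} {g} zero    _         f≤g = begin
  f 0 + ∑ n (f ∘ suc) + g 0   ≡⟨ rotate (f 0) _ (g 0) ⟩
  g 0 + ∑ n (f ∘ suc) + f 0   ≤⟨ +-monoˡ-≤ (f 0) (+-monoʳ-≤ (g 0) (∑-mono-< n λ i i<n → f≤g (suc i) (s<s i<n) λ ())) ⟩
  g 0 + ∑ n (g ∘ suc) + f 0   ∎
  where
  open ≤-Reasoning
  rotate : ∀ a b c → a + b + c ≡ c + b + a
  rotate = solve-∀
∑-except (suc n) {f} {g} (suc k) (s<s k<n) f≤g = begin
  f 0 + ∑ n (f ∘ suc) + g (suc k)    ≡⟨ +-assoc (f 0) _ _ ⟩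
  f 0 + (∑ n (f ∘ suc) + g (suc k))  ≤⟨ +-mono-≤ (f≤g 0 z<s λ ())
      (∑-except n k k<n λ i i<n i≢k → f≤g (suc i) (s<s i<n) (i≢k ∘ suc-injective)) ⟩
  g 0 + (∑ n (g ∘ suc) + f (suc k))  ≡⟨ +-assoc (g 0) _ _ ⟨
  g 0 + ∑ n (g ∘ suc) + f (suc k)    ∎
  where open ≤-Reasoning

argmax : ∀ n (f : ℕ → ℕ) → ∃ λ k → k < suc n × ∀ i → i < suc n → f i ≤ f k
argmax zero    f = 0 , z<s , λ { zero _ → ≤-refl ; (suc _) (s<s ()) }
argmax (suc n) f with argmax n (f ∘ suc)
... | k , k<n , max with ≤-total (f 0) (f (suc k))
...   | inj₁ f0≤fk = suc k , s<s k<n , λ { zero _ → f0≤fk ; (suc i) (s<s i<n) → max i i<n }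
...   | inj₂ fk≤f0 = 0 , z<s , λ { zero _ → ≤-refl ; (suc i) (s<s i<n) → ≤-trans (max i i<n) fk≤f0 }

-- Reflecting the interval from c to c + z - 1 pairs each r with the s for which r + s = 2c + z - 1.
-- Summing over these z pairs uses every `d` and every `e` on the interval exactly once.
∑-antidiagonal : ∀ z c L K (d e : ℕ → ℕ) →
                 (∀ r s → c ≤ r → r < c + z → c ≤ s → s < c + z → suc (r + s) ≡ c + c + z →
                   L ≤ K * (d r + e s)) →
                 z * L ≤ K * (∑ z (λ i → d (c + i)) + ∑ z (λ i → e (c + i)))
∑-antidiagonal z c L K d e bound = begin
  z * L                                                    ≡⟨ ∑-const z L ⟨
  ∑ z (λ _ → L)                                            ≤⟨ ∑-mono-< z bound′ ⟩
  ∑ z (λ i → K * (d (c + i) + e (c + (z ∸ suc i))))        ≡⟨ ∑-*ˡ z K _ ⟩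
  K * ∑ z (λ i → d (c + i) + e (c + (z ∸ suc i)))          ≡⟨ cong (K *_) (∑-+ z _ _) ⟩
  K * (∑ z (λ i → d (c + i)) + ∑ z (λ i → e (c + (z ∸ suc i))))
    ≡⟨ cong (λ s → K * (∑ z (λ i → d (c + i)) + s)) (∑-reverse z (λ i → e (c + i))) ⟩
  K * (∑ z (λ i → d (c + i)) + ∑ z (λ i → e (c + i)))      ∎
  where
  open ≤-Reasoning
  regroup : ∀ c i j → suc (c + i + (c + j)) ≡ c + c + (suc i + j)
  regroup = solve-∀
  bound′ : ∀ i → i < z → L ≤ K * (d (c + i) + e (c + (z ∸ suc i)))
  bound′ i i<z = bound (c + i) (c + (z ∸ suc i)) (m≤m+n c i) (+-monoʳ-< c i<z)
    (m≤m+n c _) (+-monoʳ-< c (∸-monoʳ-< z<s i<z))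
    (trans (regroup c i (z ∸ suc i)) (cong (c + c +_) (m+[n∸m]≡n i<z)))

∤⇒coprime : ∀ {p a} → Prime p → p ∤ a → Coprime a p
∤⇒coprime pp p∤a {d} (d∣a , d∣p) with prime⇒irreducible pp d∣p
... | inj₁ d≡1  = d≡1
... | inj₂ refl = contradiction d∣a p∤a

-- For `p = suc n` this runs over the nonzero residues modulo `p`, which is why primes are written
-- as `suc n` below.
∑⁺ : ℕ → (ℕ → ℕ) → ℕ
∑⁺ n f = ∑ n (f ∘ suc)

∑⁺-scale : ∀ {n u} → Coprime u (suc n) → ∀ {f} → Periodic (suc n) f →
           ∑⁺ n (λ i → f (u * i)) ≡ ∑⁺ n f
∑⁺-scale {n} {u} c {f} f-per = +-cancelˡ-≡ (f 0) _ _ (begin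
  f 0 + ∑⁺ n (λ i → f (u * i))        ≡⟨ cong (λ k → f k + ∑⁺ n (λ i → f (u * i))) (*-zeroʳ u) ⟨
  ∑ (suc n) (λ i → f (u * i))         ≡⟨ ∑-scale c f-per ⟩
  f 0 + ∑⁺ n f                        ∎)
  where open ≡-Reasoning

solve-≋ : ∀ {p} .{{_ : NonZero p}} {u} → Coprime u p → ∀ a → ∃ λ y → y < p × u * y ≋ a [ p ]
solve-≋ {p} {u} c a = v * a % p , m%n<n (v * a) p ,
  ≋-trans (≋-*ˡ u (≋-% (v * a))) (≋-trans (≋-reflexive (regroup u v a))
    (≋-trans (≋-*ˡ a vu≋1) (≋-reflexive (*-identityʳ a))))
  where
  v = proj₁ (inverse-mod c)
  vu≋1 = proj₂ (inverse-mod c)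
  regroup : ∀ u v a → u * (v * a) ≡ a * (v * u)
  regroup = solve-∀

unit∤ : ∀ {r n} → 1 ≤ r → r ≤ n → suc n ∤ r
unit∤ 1≤r r≤n = >⇒∤ {{>-nonZero 1≤r}} (s≤s r≤n)

module _ {n : ℕ} {d e : ℕ → ℕ}  where

  private
    p = suc n

  module _ {L : ℕ} (K x t₀ : ℕ) where

    -- Put y = x - t₀. The pairs with r + s = y come from reflecting the intervals 1, ..., y - 1 and
    -- y + 1, ..., n. For y ≠ 0 the residue y is lost, its partner being 0, whence the factor
    -- `pred n`.
    pairs-one : (∀ r s → p ∤ r → p ∤ s → r + s + t₀ ≋ x [ p ] → L ≤ K * (d r + e s)) →
                pred n * L ≤ K * (∑⁺ n d + ∑⁺ n e)
    pairs-one bad = go y y≤n y+t₀≋x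
      where
      open ≤-Reasoning
      y = (x + n * t₀) % p
      y≤n : y ≤ n
      y≤n = s≤s⁻¹ (m%n<n (x + n * t₀) p)
      collect : ∀ x n t → x + n * t + t ≡ x + t * suc n
      collect = solve-∀
      y+t₀≋x : y + t₀ ≋ x [ p ]
      y+t₀≋x = ≋-trans (≋-+ (≋-% (x + n * t₀)) ≋-refl)
        (≋-trans (≋-reflexive (collect x n t₀)) (≋-+-multiple x t₀))
      block : ∀ {y} c z → 1 ≤ c → c + z ≤ p → c + c + z ≋ suc y [ p ] → y + t₀ ≋ x [ p ] →
              z * L ≤ K * (∑ z (λ i → d (c + i)) + ∑ z (λ i → e (c + i)))
      block {y} c z 1≤c c+z≤p 2c+z≋1+y y+t₀≋x = ∑-antidiagonal z c L K d e λ r s c≤r r< c≤s s< r+s →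
        bad r s (unit∤ (≤-trans 1≤c c≤r) (s≤s⁻¹ (≤-trans r< c+z≤p)))
                (unit∤ (≤-trans 1≤c c≤s) (s≤s⁻¹ (≤-trans s< c+z≤p)))
                (≋-trans (≋-+ (≋-suc⁻¹ (≋-trans (≋-reflexive r+s) 2c+z≋1+y)) ≋-refl) y+t₀≋x)
      go : ∀ y → y ≤ n → y + t₀ ≋ x [ p ] → pred n * L ≤ K * (∑⁺ n d + ∑⁺ n e)
      go zero _ t₀≋x = ≤-trans (*-monoˡ-≤ L (pred[n]≤n {n}))
        (block 1 n ≤-refl ≤-refl (0 , 1 , refl) t₀≋x)
      go (suc y) y<n y+t₀≋x = begin
        pred n * L       ≡⟨ cong (λ k → pred k * L) (m+[n∸m]≡n y<n) ⟨
        (y + z) * L      ≡⟨ *-distribʳ-+ L y z ⟩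
        y * L + z * L    ≤⟨ +-mono-≤ low high ⟩
        K * (∑⁺ y d + ∑⁺ y e) + K * (hi d + hi e)      ≡⟨ regroup K (∑⁺ y d) (∑⁺ y e) (hi d) (hi e) ⟩
        K * (∑⁺ y d + hi d + (∑⁺ y e + hi e))          ≤⟨ *-monoʳ-≤ K (+-mono-≤ (grow d) (grow e)) ⟩
        K * (∑⁺ n d + ∑⁺ n e)                          ∎
        where
        z = n ∸ suc y
        hi : (ℕ → ℕ) → ℕ
        hi f = ∑ z (λ i → f (suc (suc y) + i))
        low : y * L ≤ K * (∑⁺ y d + ∑⁺ y e)
        low = block 1 y ≤-refl (s≤s (≤-trans (n≤1+n y) y<n)) ≋-refl y+t₀≋x
        high : z * L ≤ K * (hi d + hi e)
        high = block (suc (suc y)) z (s≤s z≤n) (≤-reflexive (cong suc (m+[n∸m]≡n y<n)))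
          (0 , 1 , trans (+-identityʳ _) (trans (wrap y z) (cong (λ k → suc (suc y) + (suc k + 0)) (m+[n∸m]≡n y<n)))) y+t₀≋x
          where
          wrap : ∀ y z → suc (suc y) + suc (suc y) + z ≡ suc (suc y) + (suc (suc y + z) + 0)
          wrap = solve-∀
        regroup : ∀ K a b c d → K * (a + b) + K * (c + d) ≡ K * (a + c + (b + d))
        regroup = solve-∀
        grow : ∀ f → ∑⁺ y f + hi f ≤ ∑⁺ n f
        grow f = begin
          ∑⁺ y f + hi f                   ≤⟨ +-monoˡ-≤ (hi f) (≤-trans (m≤m+n (∑⁺ y f) (f (suc y)))
                                                               (≤-reflexive (sym (∑-last y (f ∘ suc))))) ⟩
          ∑⁺ (suc y) f + hi f             ≡⟨ ∑-++ (suc y) z (f ∘ suc) ⟨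
          ∑⁺ (suc y + z) f                ≡⟨ cong (λ k → ∑⁺ k f) (m+[n∸m]≡n y<n) ⟩
          ∑⁺ n f                          ∎

  -- Writing r = D i and s = D j with D = t₀ - t₁ turns the two allowed relations into i + j = y for
  -- t₀ and i + j = y + 1 for t₁. Reflecting 1, ..., y by means of t₁ and y + 1, ..., n by means of
  -- t₀ pairs all n nonzero residues.
  pairs-two : ∀ {L} K → Prime p → Periodic p d → Periodic p e → ∀ x t₀ t₁ → ¬ t₀ ≋ t₁ [ p ] →
    (∀ r s t → p ∤ r → p ∤ s → t ≡ t₀ ⊎ t ≡ t₁ → r + s + t ≋ x [ p ] → L ≤ K * (d r + e s)) →
    n * L ≤ K * (∑⁺ n d + ∑⁺ n e)
  pairs-two {L} K pp d-per e-per x t₀ t₁ t₀≇t₁ bad = begin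
    n * L                   ≡⟨ cong (_* L) (m+[n∸m]≡n y≤n) ⟨
    (y + z) * L             ≡⟨ *-distribʳ-+ L y z ⟩
    y * L + z * L           ≤⟨ +-mono-≤ low high ⟩
    K * (∑⁺ y d′ + ∑⁺ y e′) + K * (hi d′ + hi e′)    ≡⟨ regroup K (∑⁺ y d′) (∑⁺ y e′) (hi d′) (hi e′) ⟩
    K * (∑⁺ y d′ + hi d′ + (∑⁺ y e′ + hi e′))        ≡⟨ cong₂ (λ a b → K * (a + b)) (glue d-per) (glue e-per) ⟩
    K * (∑⁺ n d + ∑⁺ n e)   ∎
    where
    open ≤-Reasoning
    -- Modulo `p` this is t₀ - t₁, since `n` represents -1.
    D = t₀ + n * t₁
    D+t₁≋t₀ : D + t₁ ≋ t₀ [ p ]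
    D+t₁≋t₀ = ≋-trans (≋-reflexive (collect t₀ n t₁)) (≋-+-multiple t₀ t₁)
      where
      collect : ∀ t₀ n t₁ → t₀ + n * t₁ + t₁ ≡ t₀ + t₁ * suc n
      collect = solve-∀
    p∤D : p ∤ D
    p∤D (divides k D≡kp) = t₀≇t₁ (≋-trans (≋-sym D+t₁≋t₀)
      (≋-trans (≋-reflexive (trans (cong (_+ t₁) D≡kp) (+-comm (k * p) t₁))) (≋-+-multiple t₁ k)))
    D⊥p = ∤⇒coprime pp p∤D
    solution = solve-≋ D⊥p (x + n * t₀)
    y = proj₁ solution
    y≤n : y ≤ n
    y≤n = s≤s⁻¹ (proj₁ (proj₂ solution))
    z = n ∸ y
    Dy+t₀≋x : D * y + t₀ ≋ x [ p ]
    Dy+t₀≋x = ≋-trans (≋-+ (proj₂ (proj₂ solution)) ≋-refl)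
      (≋-trans (≋-reflexive (collect x n t₀)) (≋-+-multiple x t₀))
      where
      collect : ∀ x n t → x + n * t + t ≡ x + t * suc n
      collect = solve-∀
    D[1+y]+t₁≋x : D * suc y + t₁ ≋ x [ p ]
    D[1+y]+t₁≋x = ≋-trans (≋-reflexive (expand D y t₁)) (≋-trans (≋-+ ≋-refl D+t₁≋t₀) Dy+t₀≋x)
      where
      expand : ∀ D y t → D * suc y + t ≡ D * y + (D + t)
      expand = solve-∀
    d′ e′ : ℕ → ℕ
    d′ i = d (D * i)
    e′ i = e (D * i)
    hi : (ℕ → ℕ) → ℕ
    hi f = ∑ z (λ i → f (suc y + i))
    D∤ : ∀ {r} → 1 ≤ r → r ≤ n → p ∤ D * r
    D∤ 1≤r r≤n p∣Dr = unit∤ 1≤r r≤n (coprime-divisor (Coprime.sym D⊥p) p∣Dr)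
    block : ∀ c w t → t ≡ t₀ ⊎ t ≡ t₁ → 1 ≤ c → c + w ≤ p →
            (∀ {k} → suc k ≡ c + c + w → D * k + t ≋ x [ p ]) →
            w * L ≤ K * (∑ w (λ i → d′ (c + i)) + ∑ w (λ i → e′ (c + i)))
    block c w t t∈ 1≤c c+w≤p ≋x = ∑-antidiagonal w c L K d′ e′ λ r s c≤r r< c≤s s< r+s →
      bad (D * r) (D * s) t
        (D∤ (≤-trans 1≤c c≤r) (s≤s⁻¹ (≤-trans r< c+w≤p)))
        (D∤ (≤-trans 1≤c c≤s) (s≤s⁻¹ (≤-trans s< c+w≤p))) t∈
        (≋-trans (≋-reflexive (cong (_+ t) (sym (*-distribˡ-+ D r s)))) (≋x r+s))
    low : y * L ≤ K * (∑⁺ y d′ + ∑⁺ y e′)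
    low = block 1 y t₁ (inj₂ refl) ≤-refl (s≤s y≤n) λ { refl → D[1+y]+t₁≋x }
    high : z * L ≤ K * (hi d′ + hi e′)
    high = block (suc y) z t₀ (inj₁ refl) (s≤s z≤n) (≤-reflexive (cong suc y+z≡n))
      λ {k} 1+k≡ → ≋-trans (≋-+ (≋-trans (≋-*ˡ D (≋-reflexive (k≡ 1+k≡))) (≋-*ˡ D (≋-+-multiple y 1))) ≋-refl) Dy+t₀≋x
      where
      y+z≡n = m+[n∸m]≡n y≤n
      wrap : ∀ y z → y + suc y + z ≡ y + 1 * suc (y + z)
      wrap = solve-∀
      k≡ : ∀ {k} → suc k ≡ suc y + suc y + z → k ≡ y + 1 * p
      k≡ 1+k≡ = trans (suc-injective 1+k≡) (trans (wrap y z) (cong (λ k → y + 1 * suc k) y+z≡n))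
    regroup : ∀ K a b c d → K * (a + b) + K * (c + d) ≡ K * (a + c + (b + d))
    regroup = solve-∀
    glue : ∀ {f} → Periodic p f → ∑⁺ y (λ i → f (D * i)) + hi (λ i → f (D * i)) ≡ ∑⁺ n f
    glue {f} f-per = begin-equality
      ∑⁺ y (λ i → f (D * i)) + hi (λ i → f (D * i))    ≡⟨ ∑-++ y z (λ i → f (D * suc i)) ⟨
      ∑ (y + z) (λ i → f (D * suc i))      ≡⟨ cong (λ k → ∑ k (λ i → f (D * suc i))) (m+[n∸m]≡n y≤n) ⟩
      ∑⁺ n (λ i → f (D * i))               ≡⟨ ∑⁺-scale D⊥p f-per ⟩
      ∑⁺ n f                               ∎

-- For w ≤ N put u = N - w: the inequality for `Y` amounts to Y u ≤ R w, which survives lowering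
-- `Y`. The bound coming from a large fibre can thus be weakened to the one for a smaller fibre.
thin-mono : ∀ {X Y} N R w → X ≤ Y → Y * N ≤ (Y + R) * w → X * N ≤ (X + R) * w
thin-mono {X} {Y} N R w X≤Y bad with ≤-total N w
... | inj₁ N≤w = ≤-trans (*-monoʳ-≤ X N≤w) (*-monoˡ-≤ w (m≤m+n X R))
... | inj₂ w≤N = begin
  X * N              ≡⟨ cong (X *_) N≡ ⟨
  X * (w + u)        ≡⟨ *-distribˡ-+ X w u ⟩
  X * w + X * u      ≤⟨ +-monoʳ-≤ (X * w) (≤-trans (*-monoˡ-≤ u X≤Y) Yu≤Rw) ⟩
  X * w + R * w      ≡⟨ *-distribʳ-+ w X R ⟨
  (X + R) * w        ∎
  where
  open ≤-Reasoning
  u = N ∸ w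
  N≡ : w + u ≡ N
  N≡ = m+[n∸m]≡n w≤N
  Yu≤Rw : Y * u ≤ R * w
  Yu≤Rw = +-cancelˡ-≤ (Y * w) _ _ (begin
    Y * w + Y * u    ≡⟨ *-distribˡ-+ Y w u ⟨
    Y * (w + u)      ≡⟨ cong (Y *_) N≡ ⟩
    Y * N            ≤⟨ bad ⟩
    (Y + R) * w      ≡⟨ *-distribʳ-+ w Y R ⟩
    Y * w + R * w    ∎)

module _ {n : ℕ} (pp : Prime (suc n)) {d e h : ℕ → ℕ} (N Q P x : ℕ)
         (d-per : Periodic (suc n) d) (e-per : Periodic (suc n) e)
         (bad : ∀ r s t → suc n ∤ r → suc n ∤ s → suc n ∤ t → r + s + t ≋ x [ suc n ] →
                Q * h t * N ≤ (Q * h t + P * N) * (d r + e s)) where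

  private
    p = suc n
    Δ = ∑⁺ n d + ∑⁺ n e
    Γ = ∑⁺ n h

  -- By `thin-mono` the larger fibre at `t₀` also yields the inequality with `h t₁`, so both
  -- residues can serve in `pairs-two` and no pair is lost.
  runner-up : ∀ {t₀ t₁} → p ∤ t₀ → p ∤ t₁ → ¬ t₀ ≋ t₁ [ p ] → h t₁ ≤ h t₀ →
              n * (Q * h t₁ * N) ≤ (Q * h t₁ + P * N) * Δ
  runner-up {t₀} {t₁} p∤t₀ p∤t₁ t₀≇t₁ h₁≤h₀ = pairs-two (Q * h t₁ + P * N) pp d-per e-per x t₀ t₁ t₀≇t₁ λ where
    r s t p∤r p∤s (inj₁ refl) ≋x → thin-mono N (P * N) (d r + e s) (*-monoʳ-≤ Q h₁≤h₀) (bad r s t p∤r p∤s p∤t₀ ≋x)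
    r s t p∤r p∤s (inj₂ refl) ≋x → bad r s t p∤r p∤s p∤t₁ ≋x

distinct : ∀ {n i j} → i < n → j < n → i ≢ j → ¬ suc j ≋ suc i [ suc n ]
distinct i<n j<n i≢j j≋i = i≢j (sym (suc-injective (≋-<⇒≡ j≋i (s<s j<n) (s<s i<n))))

module _ {n : ℕ} (pp : Prime (suc n)) {d e h : ℕ → ℕ} (N Q P x : ℕ)
         (d-per : Periodic (suc n) d) (e-per : Periodic (suc n) e)
         (h≤N : ∀ t → h t ≤ N)
         (bad : ∀ r s t → suc n ∤ r → suc n ∤ s → suc n ∤ t → r + s + t ≋ x [ suc n ] →
                Q * h t * N ≤ (Q * h t + P * N) * (d r + e s)) where

  -- `runner-up` bounds every fibre of `h` but the largest, with factor n; the largest has only the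
  -- `pred n` pairs of `pairs-one`. Scaling the former by n - 1 and the latter by n gives both the
  -- same coefficient of `h`, and the only loss is one extra term at `i₀`.
  average : let ν = n * pred n ; Γ = ∑⁺ n h in
            Q * ν * Γ * (n * N) ≤ (Q * ν * Γ + (P * suc ν + Q) * (n * N)) * (∑⁺ n d + ∑⁺ n e)
  average = go n refl
    where
    Δ = ∑⁺ n d + ∑⁺ n e
    Γ = ∑⁺ n h
    R = P * N
    -- Matching on a copy of `n` lets `pred n` reduce to `k`.
    go : ∀ m → m ≡ n → let ν = m * pred m in
         Q * ν * Γ * (m * N) ≤ (Q * ν * Γ + (P * suc ν + Q) * (m * N)) * Δ
    go zero    _    = ≤-trans (≤-reflexive (*-zeroʳ (Q * 0 * Γ))) z≤n
    go (suc k) refl = begin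
      Q * (n * k) * Γ * (n * N)                            ≡⟨ lhs Q n k Γ N ⟩
      n * (k * n * N * Q * Γ)                                ≤⟨ *-monoʳ-≤ n main ⟩
      n * ((k * Q * Γ + (n * k + 1) * R + Q * N) * Δ)      ≡⟨ rhs Q P n k Γ N Δ ⟩
      (Q * (n * k) * Γ + (P * suc (n * k) + Q) * (n * N)) * Δ ∎
      where
      open ≤-Reasoning
      lhs : ∀ Q n k Γ N → Q * (n * k) * Γ * (n * N) ≡ n * (k * n * N * Q * Γ)
      lhs = solve-∀
      rhs : ∀ Q P n k Γ N Δ → n * ((k * Q * Γ + (n * k + 1) * (P * N) + Q * N) * Δ) ≡
            (Q * (n * k) * Γ + (P * suc (n * k) + Q) * (n * N)) * Δ
      rhs = solve-∀
      top = argmax k (h ∘ suc)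
      i₀ = proj₁ top
      i₀<n = proj₁ (proj₂ top)
      G = h (suc i₀)
      f g : ℕ → ℕ
      f i = k * n * N * Q * h (suc i)
      g i = k * Q * Δ * h (suc i) + k * R * Δ
      p∤ : ∀ {i} → i < n → suc n ∤ suc i
      p∤ i<n = unit∤ (s≤s z≤n) i<n
      f≤g : ∀ i → i < n → i ≢ i₀ → f i ≤ g i
      f≤g i i<n i≢i₀ = begin
        k * n * N * Q * h (suc i)            ≡⟨ l k n N Q (h (suc i)) ⟩
        k * (n * (Q * h (suc i) * N))        ≤⟨ *-monoʳ-≤ k (runner-up pp N Q P x d-per e-per bad
                                                (p∤ i₀<n) (p∤ i<n) (distinct i<n i₀<n i≢i₀) (proj₂ (proj₂ top) i i<n)) ⟩
        k * ((Q * h (suc i) + R) * Δ)        ≡⟨ r k Q (h (suc i)) R Δ ⟩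
        k * Q * Δ * h (suc i) + k * R * Δ    ∎
        where
        l : ∀ k n N Q H → k * n * N * Q * H ≡ k * (n * (Q * H * N))
        l = solve-∀
        r : ∀ k Q H R Δ → k * ((Q * H + R) * Δ) ≡ k * Q * Δ * H + k * R * Δ
        r = solve-∀
      -- The weight `n = suc k` in place of `k` costs one extra `(Q * G + R) * Δ`, where `G ≤ N`.
      -- The `k * R * Δ` added on the left turns the extra `R` on the right into `n * R`.
      f₀≤ : f i₀ + k * R * Δ ≤ g i₀ + (Q * N + n * R) * Δ
      f₀≤ = begin
        k * n * N * Q * G + k * R * Δ                ≡⟨ cong (_+ k * R * Δ) (l k n N Q G) ⟩
        n * (k * (Q * G * N)) + k * R * Δ            ≤⟨ +-monoˡ-≤ (k * R * Δ) (*-monoʳ-≤ n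
                                                         (pairs-one {n} {d} {e} (Q * G + R) x (suc i₀)
                                                         λ r s p∤r p∤s → bad r s (suc i₀) p∤r p∤s (p∤ i₀<n))) ⟩
        n * ((Q * G + R) * Δ) + k * R * Δ            ≡⟨ r k Q G R Δ ⟩
        k * Q * Δ * G + k * R * Δ + (Q * G + n * R) * Δ
          ≤⟨ +-monoʳ-≤ (g i₀) (*-monoˡ-≤ Δ (+-monoˡ-≤ (n * R) (*-monoʳ-≤ Q (h≤N (suc i₀))))) ⟩
        g i₀ + (Q * N + n * R) * Δ                   ∎
        where
        l : ∀ k n N Q H → k * n * N * Q * H ≡ n * (k * (Q * H * N))
        l = solve-∀
        r : ∀ k Q G R Δ → suc k * ((Q * G + R) * Δ) + k * R * Δ ≡
            k * Q * Δ * G + k * R * Δ + (Q * G + suc k * R) * Δ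
        r = solve-∀
      ∑g : ∑ n g ≡ k * Q * Δ * Γ + n * (k * R * Δ)
      ∑g = trans (∑-+ n (λ i → k * Q * Δ * h (suc i)) (λ _ → k * R * Δ))
        (cong₂ _+_ (∑-*ˡ n (k * Q * Δ) (h ∘ suc)) (∑-const n (k * R * Δ)))
      main : k * n * N * Q * Γ ≤ (k * Q * Γ + (n * k + 1) * R + Q * N) * Δ
      main = +-cancelʳ-≤ (k * R * Δ + g i₀) _ _ (begin
        k * n * N * Q * Γ + (k * R * Δ + g i₀)         ≡⟨ cong (_+ (k * R * Δ + g i₀)) (∑-*ˡ n (k * n * N * Q) (h ∘ suc)) ⟨
        ∑ n f + (k * R * Δ + g i₀)                     ≡⟨ a (∑ n f) (k * R * Δ) (g i₀) ⟩
        ∑ n f + g i₀ + k * R * Δ                       ≤⟨ +-monoˡ-≤ (k * R * Δ) (∑-except n i₀ i₀<n f≤g) ⟩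
        ∑ n g + f i₀ + k * R * Δ                       ≡⟨ +-assoc (∑ n g) (f i₀) _ ⟩
        ∑ n g + (f i₀ + k * R * Δ)                     ≤⟨ +-monoʳ-≤ (∑ n g) f₀≤ ⟩
        ∑ n g + (g i₀ + (Q * N + n * R) * Δ)           ≡⟨ cong (_+ (g i₀ + (Q * N + n * R) * Δ)) ∑g ⟩
        k * Q * Δ * Γ + n * (k * R * Δ) + (g i₀ + (Q * N + n * R) * Δ)   ≡⟨ b k Q Δ Γ R N (g i₀) ⟩
        (k * Q * Γ + (n * k + 1) * R + Q * N) * Δ + (k * R * Δ + g i₀)   ∎)
        where
        a : ∀ x y z → x + (y + z) ≡ x + z + y
        a = solve-∀
        b : ∀ k Q Δ Γ R N G → k * Q * Δ * Γ + suc k * (k * R * Δ) + (G + (Q * N + suc k * R) * Δ) ≡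
            (k * Q * Γ + (suc k * k + 1) * R + Q * N) * Δ + (k * R * Δ + G)
        b = solve-∀

-- Counting units and removing a prime

indicator : Bool → ℕ
indicator b = if b then 1 else 0

weight : ℕ → (ℕ → Bool) → ℕ → ℕ
weight m A a = indicator (does (coprime? a m) ∧ A a)

count : ℕ → (ℕ → Bool) → ℕ
count m A = ∑ m (weight m A)

totient : ℕ → ℕ
totient m = count m (const true)

count-complement : ∀ m A → count m A + count m (not ∘ A) ≡ totient m
count-complement m A = trans (sym (∑-+ m (weight m A) (weight m (not ∘ A))))
  (∑-cong m λ a → split (does (coprime? a m)) (A a))
  where
  split : ∀ u b → indicator (u ∧ b) + indicator (u ∧ not b) ≡ indicator (u ∧ true)
  split false _     = refl
  split true  false = refl
  split true  true  = refl

count≤totient : ∀ m A → count m A ≤ totient m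
count≤totient m A = m+n≤o⇒m≤o (count m A) (≤-reflexive (count-complement m A))

∣m+n∣n⇒∣m : ∀ {d m n} → d ∣ m + n → d ∣ n → d ∣ m
∣m+n∣n⇒∣m {d} {m} {n} d∣m+n = ∣m+n∣m⇒∣n (subst (d ∣_) (+-comm m n) d∣m+n)

coprime-+ʳ : ∀ {a m} → Coprime (a + m) m ⇔ Coprime a m
coprime-+ʳ {a} {m} = mk⇔ {A = Coprime (a + m) m} {B = Coprime a m}
                 (λ c (d∣a , d∣m) → c (∣m∣n⇒∣m+n d∣a d∣m , d∣m))
                 (λ c (d∣a+m , d∣m) → c (∣m+n∣n⇒∣m d∣a+m d∣m , d∣m))

weight-periodic : ∀ {m A} → Periodic m A → Periodic m (weight m A)
weight-periodic {m} A-per a = cong₂ (λ u b → indicator (u ∧ b))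
  (does-⇔ coprime-+ʳ (coprime? (a + m) m) (coprime? a m)) (A-per a)

coprime-*ʳ : ∀ {a b c} → Coprime a b → Coprime a c → Coprime a (b * c)
coprime-*ʳ a⊥b a⊥c (d∣a , d∣bc) =
  a⊥c (d∣a , coprime-divisor (λ (e∣d , e∣b) → a⊥b (∣-trans e∣d d∣a , e∣b)) d∣bc)

≋-scale : ∀ c {a b m} → a ≋ b [ m ] → c * a ≋ c * b [ c * m ]
≋-scale c {a} {b} {m} (k , l , eq) = k , l ,
  trans (factor c a k m) (trans (cong (c *_) eq) (sym (factor c b l m)))
  where
  factor : ∀ c a k m → c * a + k * (c * m) ≡ c * (a + k * m)
  factor = solve-∀

-- Three sets are kept apart because the fibres of a single set over different residues may differ.
NoSolution : ℕ → (A B C : ℕ → Bool) → ℕ → Set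
NoSolution m A B C x = ∀ {a b c} → Coprime a m → Coprime b m → Coprime c m →
  A a ≡ true → B b ≡ true → C c ≡ true → ¬ a + b + c ≋ x [ m ]

-- Dividing by φ(m), with c the density of C and d the sum of the codensities of A and B, this reads
-- c (1 - d) ≤ (P / Q) d.
Bound : ℕ → ℕ → ℕ → Set
Bound m P Q = ∀ {A B C} x → Periodic m A → Periodic m B → Periodic m C → NoSolution m A B C x →
  Q * count m C * totient m ≤ (Q * count m C + P * totient m) * (count m (not ∘ A) + count m (not ∘ B))

-- ℤ/m × ℤ/p ≅ ℤ/pm via (i , j) ↦ p i + m j: unlike the usual Chinese remainder map, this
-- additive isomorphism has an explicit formula.
module Fibres {n m : ℕ} (pp : Prime (suc n)) (m⊥p : Coprime m (suc n)) .{{_ : NonZero m}} where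

  private
    p = suc n

  fibre : (ℕ → Bool) → ℕ → ℕ → Bool
  fibre A j i = A (p * i + m * j)

  fibre-periodic : ∀ {A} → Periodic (p * m) A → ∀ j → Periodic m (fibre A j)
  fibre-periodic {A} A-per j i = trans (cong A (shift p i m j)) (A-per _)
    where
    shift : ∀ p i m j → p * (i + m) + m * j ≡ p * i + m * j + p * m
    shift = solve-∀

  count-fibre-periodic : ∀ {A} → Periodic (p * m) A → Periodic p (λ j → count m (fibre A j))
  count-fibre-periodic {A} A-per j = ∑-cong m λ i → cong (λ b → indicator (does (coprime? i m) ∧ b))
    (trans (cong A (shift p i m j)) (A-per _))
    where
    shift : ∀ p i m j → p * i + m * (j + p) ≡ p * i + m * j + p * m
    shift = solve-∀

  -- Modulo `p` the element is `m * j` and modulo `m` it is `p * i`, while `m` and `p` are units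
  -- modulo each other.
  unit-fibre : ∀ {i j} → p ∤ j → Coprime (p * i + m * j) (p * m) ⇔ Coprime i m
  unit-fibre {i} {j} p∤j = mk⇔ {A = Coprime (p * i + m * j) (p * m)} {B = Coprime i m}
    (λ c (d∣i , d∣m) → c (∣m∣n⇒∣m+n (∣n⇒∣m*n p d∣i) (∣m⇒∣m*n j d∣m) , ∣n⇒∣m*n p d∣m))
    (λ c → coprime-*ʳ
      (∤⇒coprime pp λ p∣a → p∤j (coprime-divisor (Coprime.sym m⊥p) (∣m+n∣m⇒∣n p∣a (m∣m*n i))))
      (λ (d∣a , d∣m) → c (coprime-divisor (λ (e∣d , e∣p) → m⊥p (∣-trans e∣d d∣m , e∣p))
                                          (∣m+n∣n⇒∣m d∣a (∣m⇒∣m*n j d∣m)) , d∣m)))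

  zero-fibre : ∀ i → ¬ Coprime (p * i + m * 0) (p * m)
  zero-fibre i c = contradiction (c (p∣pi+m0 , m∣m*n m)) λ { refl → ¬prime[1] pp }
    where
    p∣pi+m0 : p ∣ p * i + m * 0
    p∣pi+m0 = ∣m∣n⇒∣m+n (m∣m*n i) (subst (p ∣_) (sym (*-zeroʳ m)) (p ∣0))

  count-fibres : ∀ {A} → Periodic (p * m) A → count (p * m) A ≡ ∑⁺ n (λ j → count m (fibre A j))
  count-fibres {A} A-per = begin
    count (p * m) A                            ≡⟨ ∑-crt p m m⊥p (weight-periodic {p * m} {A} A-per) ⟩
    ∑ m (λ i → w i 0) + ∑ n (λ j → ∑ m λ i → w i (suc j))
      ≡⟨ cong₂ _+_
           (trans (∑-cong m (λ i → cong (λ u → indicator (u ∧ A (p * i + m * 0)))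
                                        (dec-false (coprime? _ _) (zero-fibre i))))
                  (trans (∑-const m 0) (*-zeroʳ m)))
           (∑-cong-< n λ j j<n → ∑-cong m λ i → cong (λ u → indicator (u ∧ fibre A (suc j) i))
              (does-⇔ (unit-fibre (unit∤ (s≤s z≤n) j<n)) (coprime? _ _) (coprime? i m))) ⟩
    ∑⁺ n (λ j → count m (fibre A j))           ∎
    where
    open ≡-Reasoning
    w : ℕ → ℕ → ℕ
    w i j = weight (p * m) A (p * i + m * j)

  totient-* : totient (p * m) ≡ n * totient m
  totient-* = trans (count-fibres λ _ → refl) (∑-const n (totient m))

  fibre-no-solution : ∀ {A B C} x → NoSolution (p * m) A B C x → ∃₂ λ x₁ x₂ →
    ∀ r s t → p ∤ r → p ∤ s → p ∤ t → r + s + t ≋ x₂ [ p ] → NoSolution m (fibre A r) (fibre B s) (fibre C t) x₁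
  fibre-no-solution {A} {B} {C} x noSol = x₁ , x₂ , λ r s t p∤r p∤s p∤t r+s+t≋x₂ {a} {b} {c} a⊥m b⊥m c⊥m Aa Bb Cc a+b+c≋x₁ →
    noSol (from (unit-fibre p∤r) a⊥m) (from (unit-fibre p∤s) b⊥m) (from (unit-fibre p∤t) c⊥m) Aa Bb Cc
      (≋-trans (≋-reflexive (regroup p m a b c r s t))
      (≋-trans (≋-+ (≋-scale p a+b+c≋x₁) (subst (λ q → m * (r + s + t) ≋ m * x₂ [ q ]) (*-comm m p) (≋-scale m r+s+t≋x₂)))
               x₁x₂≋x))
    where
    open Equivalence using (from)
    solution = solve-≋ m⊥p x
    x₂ = proj₁ solution
    k = proj₁ (proj₂ (proj₂ solution))
    l = proj₁ (proj₂ (proj₂ (proj₂ solution)))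
    mx₂+kp≡x+lp = proj₂ (proj₂ (proj₂ (proj₂ solution)))
    -- Since `m * x₂ + k * p = x + l * p`, the quotient (x - m x₂) / p is k - l, with -l written as
    -- `pred m * l`.
    x₁ = k + pred m * l
    pair : ∀ p m a b r s → p * a + m * r + (p * b + m * s) ≡ p * (a + b) + m * (r + s)
    pair = solve-∀
    regroup : ∀ p m a b c r s t → p * a + m * r + (p * b + m * s) + (p * c + m * t) ≡ p * (a + b + c) + m * (r + s + t)
    regroup p m a b c r s t = trans (cong (_+ (p * c + m * t)) (pair p m a b r s)) (pair p m (a + b) c (r + s) t)
    x₁x₂≋x : p * x₁ + m * x₂ ≋ x [ p * m ]
    x₁x₂≋x = ≋-trans (≋-reflexive (begin
      p * (k + pred m * l) + m * x₂      ≡⟨ a p k (pred m * l) (m * x₂) ⟩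
      m * x₂ + k * p + p * (pred m * l)  ≡⟨ cong (_+ p * (pred m * l)) mx₂+kp≡x+lp ⟩
      x + l * p + p * (pred m * l)       ≡⟨ b x l p (pred m) ⟩
      x + l * (p * suc (pred m))         ≡⟨ cong (λ m → x + l * (p * m)) (suc-pred m) ⟩
      x + l * (p * m)                    ∎)) (≋-+-multiple x l)
      where
      open ≡-Reasoning
      a : ∀ p k q y → p * (k + q) + y ≡ y + k * p + p * q
      a = solve-∀
      b : ∀ x l p q → x + l * p + p * (q * l) ≡ x + l * (p * suc q)
      b = solve-∀

  -- With ε = P / Q, the new constants replace 1 + ε by (1 + ε)(1 + 1/ν), where ν = (p - 1)(p - 2).
  -- Each prime thus contributes its factor to the product.
  peel : ∀ {P Q} → Bound m P Q → let ν = n * pred n in Bound (p * m) (P * suc ν + Q) (Q * ν)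
  peel {P} {Q} bound {A} {B} {C} x A-per B-per C-per noSol = begin
    Q * ν * count (p * m) C * totient (p * m)   ≡⟨ cong₂ (λ γ N → Q * ν * γ * N) count-C totient-* ⟩
    Q * ν * γ * (n * N)                     ≤⟨ average pp N Q P (proj₁ (proj₂ decomposed))
        (count-fibre-periodic {not ∘ A} (cong not ∘ A-per)) (count-fibre-periodic {not ∘ B} (cong not ∘ B-per))
        (λ t → count≤totient m (fibre C t)) bad ⟩
    (Q * ν * γ + R * (n * N)) * (∑⁺ n δᴬ + ∑⁺ n δᴮ)
      ≡⟨ cong₂ _*_ (cong₂ (λ γ N → Q * ν * γ + R * N) count-C totient-*)
                   (cong₂ _+_ (count-fibres {not ∘ A} (cong not ∘ A-per)) (count-fibres {not ∘ B} (cong not ∘ B-per))) ⟨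
    (Q * ν * count (p * m) C + R * totient (p * m)) * (count (p * m) (not ∘ A) + count (p * m) (not ∘ B))  ∎
    where
    open ≤-Reasoning
    ν = n * pred n
    R = P * suc ν + Q
    N = totient m
    δᴬ δᴮ : ℕ → ℕ
    δᴬ j = count m (not ∘ fibre A j)
    δᴮ j = count m (not ∘ fibre B j)
    γ = ∑⁺ n (λ j → count m (fibre C j))
    count-C : count (p * m) C ≡ γ
    count-C = count-fibres {C} C-per
    decomposed = fibre-no-solution {A} {B} {C} x noSol
    bad : ∀ r s t → p ∤ r → p ∤ s → p ∤ t → r + s + t ≋ proj₁ (proj₂ decomposed) [ p ] →
          Q * count m (fibre C t) * N ≤ (Q * count m (fibre C t) + P * N) * (δᴬ r + δᴮ s)
    bad r s t p∤r p∤s p∤t r+s+t≋x₂ = bound (proj₁ decomposed)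
      (fibre-periodic {A} A-per r) (fibre-periodic {B} B-per s) (fibre-periodic {C} C-per t)
      (proj₂ (proj₂ decomposed) r s t p∤r p∤s p∤t r+s+t≋x₂)

bound-mono : ∀ {m P Q P′ Q′} → .{{NonZero Q}} → P * Q′ ≤ P′ * Q → Bound m P Q → Bound m P′ Q′
bound-mono {m} {P} {Q} {P′} {Q′} PQ′≤P′Q bound {A} {B} {C} x A-per B-per C-per noSol = *-cancelˡ-≤ Q (begin
  Q * (Q′ * γ * N)             ≡⟨ a Q Q′ γ N ⟩
  Q′ * (Q * γ * N)             ≤⟨ *-monoʳ-≤ Q′ (bound x A-per B-per C-per noSol) ⟩
  Q′ * ((Q * γ + P * N) * δ)   ≡⟨ b Q Q′ γ P N δ ⟩
  (Q * Q′ * γ + P * Q′ * N) * δ  ≤⟨ *-monoˡ-≤ δ (+-monoʳ-≤ (Q * Q′ * γ) (*-monoˡ-≤ N PQ′≤P′Q)) ⟩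
  (Q * Q′ * γ + P′ * Q * N) * δ  ≡⟨ c Q Q′ γ P′ N δ ⟩
  Q * ((Q′ * γ + P′ * N) * δ)  ∎)
  where
  open ≤-Reasoning
  γ = count m C
  N = totient m
  δ = count m (not ∘ A) + count m (not ∘ B)
  a : ∀ Q Q′ γ N → Q * (Q′ * γ * N) ≡ Q′ * (Q * γ * N)
  a = solve-∀
  b : ∀ Q Q′ γ P N δ → Q′ * ((Q * γ + P * N) * δ) ≡ (Q * Q′ * γ + P * Q′ * N) * δ
  b = solve-∀
  c : ∀ Q Q′ γ P N δ → (Q * Q′ * γ + P * Q * N) * δ ≡ Q * ((Q′ * γ + P * N) * δ)
  c = solve-∀

-- Moduli coprime to 30

-- Modulo 1 each set is empty or everything. If A or B is empty, the codensities add up to at least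
-- 1; if C is empty, the left side vanishes; otherwise 0 + 0 + 0 hits every target.
bound-1 : ∀ P Q → Bound 1 P Q
bound-1 P Q {A} {B} {C} x _ _ _ noSol = cases (A 0) (B 0) (C 0) refl refl refl
  where
  γ = Q * count 1 C
  α′ = count 1 (not ∘ A)
  β′ = count 1 (not ∘ B)
  missing : ∀ D → D 0 ≡ false → 1 ≤ count 1 (not ∘ D)
  missing D D0 = ≤-reflexive (sym (cong (λ b → indicator (not b) + 0) D0))
  absorb : 1 ≤ α′ + β′ → γ * 1 ≤ (γ + P * 1) * (α′ + β′)
  absorb = *-mono-≤ (m≤m+n γ (P * 1))
  0⊥1 : Coprime 0 1
  0⊥1 (_ , d∣1) = ∣1⇒≡1 d∣1
  cases : ∀ a b c → A 0 ≡ a → B 0 ≡ b → C 0 ≡ c → γ * 1 ≤ (γ + P * 1) * (α′ + β′)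
  cases false _     _     A0 _  _  = absorb (≤-trans (missing A A0) (m≤m+n α′ β′))
  cases true  false _     _  B0 _  = absorb (≤-trans (missing B B0) (m≤n+m β′ α′))
  cases true  true  false _  _  C0 = ≤-trans (≤-reflexive (trans (*-identityʳ γ)
    (trans (cong (λ b → Q * (indicator b + 0)) C0) (*-zeroʳ Q)))) z≤n
  cases true  true  true  A0 B0 C0 = contradiction (x , 0 , trans (*-identityʳ x) (sym (+-identityʳ x)))
    (noSol 0⊥1 0⊥1 0⊥1 A0 B0 C0)

-- This is the state of a trial division whose next candidate is `q`. `M` stays fixed while `m`
-- shrinks to cofactors, so the recursion can stop once `q` exceeds `M`.
record Sifted (M q m : ℕ) : Set where
  constructor sifted
  field
    squarefree : SquareFree m
    odd        : 2 ∤ m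
    3∤         : 3 ∤ m
    rough      : q Rough m
    bounded    : m ≤ M

odd⇒nonZero : ∀ {m} → 2 ∤ m → NonZero m
odd⇒nonZero {zero}  2∤0 = contradiction (2 ∣0) 2∤0
odd⇒nonZero {suc m} _   = _

skip : ∀ {M q m} → Sifted M q m → q ∤ m → Sifted M (suc q) m
skip (sifted sq odd 3∤ rough m≤M) q∤m = sifted sq odd 3∤ (∤⇒rough-suc q∤m rough) m≤M

squarefree-∣ : ∀ {m k} → SquareFree m → k ∣ m → SquareFree k
squarefree-∣ sq k∣m d d²∣k = sq d (∣-trans d²∣k k∣m)

squarefree-cofactor : ∀ {k p} → Prime p → SquareFree (k * p) → Coprime k p
squarefree-cofactor {k} {p} pp sq = ∤⇒coprime pp λ p∣k →
  ¬prime[1] (subst Prime (sq p (*-monoˡ-∣ p p∣k)) pp)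

-- The resulting constants must not depend on whether `suc n` divides `m`. If it does, roughness
-- makes it prime and `peel` applies to the cofactor; if not, the bound from `next` is weakened to
-- the same constants.
sift : ∀ {M n P Q} → .{{_ : NonTrivial (suc n)}} → .{{NonZero Q}} →
       (∀ {m} → Sifted M (suc (suc n)) m → Bound m P Q) →
       let ν = n * pred n in ∀ {m} → Sifted M (suc n) m → Bound m (P * suc ν + Q) (Q * ν)
sift {M} {n} {P} {Q} next {m} s@(sifted sq odd 3∤ rough m≤M) with suc n ∣? m
... | no  q∤m = bound-mono {m} {P} {Q} {P * suc ν + Q} {Q * ν} (begin
    P * (Q * ν)          ≤⟨ m≤m+n (P * (Q * ν)) ((P + Q) * Q) ⟩
    P * (Q * ν) + (P + Q) * Q        ≡⟨ regroup P Q ν ⟩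
    (P * suc ν + Q) * Q              ∎) (next (skip s q∤m))
  where
  open ≤-Reasoning
  ν = n * pred n
  regroup : ∀ P Q ν → P * (Q * ν) + (P + Q) * Q ≡ (P * suc ν + Q) * Q
  regroup = solve-∀
... | yes q∣m@(divides k refl) = subst (λ m → Bound m (P * suc ν + Q) (Q * ν)) (*-comm (suc n) k)
    (Fibres.peel pp k⊥p {{odd⇒nonZero 2∤k}} {P} {Q} (next (sifted (squarefree-∣ sq k∣m) 2∤k
      (λ 3∣k → 3∤ (∣-trans 3∣k k∣m))
      (∤⇒rough-suc q∤k (rough∧∣⇒rough rough k∣m))
      (≤-trans (∣⇒≤ {{odd⇒nonZero odd}} k∣m) m≤M))))
  where
  ν = n * pred n
  pp : Prime (suc n)
  pp = rough∧∣⇒prime rough q∣m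
  k∣m : k ∣ k * suc n
  k∣m = m∣m*n (suc n)
  k⊥p = squarefree-cofactor pp sq
  2∤k : 2 ∤ k
  2∤k 2∣k = odd (∣-trans 2∣k k∣m)
  q∤k : suc n ∤ k
  q∤k q∣k = ¬prime[1] (subst Prime (k⊥p (q∣k , ∣-refl)) pp)

-- If all prime factors of m are at least 6k + 7 then ∏ (1 + 1/((p - 1)(p - 2))) ≤ 1 + 1/(18k + 12):
-- the right-hand side is chosen to telescope over the candidates 6k + 7 and 6k + 11.
bound-sifted : ∀ {M} fuel k → M < 7 + 6 * (fuel + k) → ∀ {m} → Sifted M (7 + 6 * k) m → Bound m 1 (12 + 18 * k)
-- Once the fuel is spent, m ≤ M < 7 + 6k while m has no divisor from 2 to 6 + 6k, so only m = 1
-- remains.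
bound-sifted zero    k M< {zero}        (sifted _ odd _ _ _) = contradiction (2 ∣0) odd
bound-sifted zero    k M< {1}           _                    = bound-1 1 (12 + 18 * k)
bound-sifted zero    k M< {suc (suc m)} (sifted _ _ _ rough m≤M) =
  contradiction (rough⇒≤ rough) (<⇒≱ (≤-<-trans m≤M M<))
bound-sifted {M} (suc fuel) k M< {m} s = bound-mono {m} {P₂} {Q₂} {1} {12 + 18 * k} telescope
  -- Only 7 + 6k and 11 + 6k are sifted: 8 + 6k, 9 + 6k, 10 + 6k and 12 + 6k are multiples of 2 or
  -- 3.
  (sift {P = P₁} {Q₁} (λ s₈ → sift {P = 1} {Q₀} (λ s₁₂ → tail (skip s₁₂ (2∤⇒ s₁₂ 6)))
    (skip (skip (skip s₈ (2∤⇒ s₈ 4)) (3∤⇒ s₈ 3)) (2∤⇒ s₈ 5))) s)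
  where
  -- The recursive call supplies ε = 1 / Q₀; the indices 1 and 2 then belong to the candidates 11 +
  -- 6k and 7 + 6k.
  Q₀ = 12 + 18 * suc k
  ν₁ = (10 + 6 * k) * (9 + 6 * k)
  P₁ = 1 * suc ν₁ + Q₀
  Q₁ = Q₀ * ν₁
  ν₂ = (6 + 6 * k) * (5 + 6 * k)
  P₂ = P₁ * suc ν₂ + Q₁
  Q₂ = Q₁ * ν₂
  tail : ∀ {m} → Sifted M (13 + 6 * k) m → Bound m 1 Q₀
  tail {m} s₁₃ = bound-sifted fuel (suc k) (subst (λ j → M < 7 + 6 * j) (sym (+-suc fuel k)) M<)
    (subst (λ j → Sifted M (7 + j) m) (sym (*-suc 6 k)) s₁₃)
  2∤⇒ : ∀ {q m} → Sifted M q m → ∀ c → c * 2 + 6 * k ∤ m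
  2∤⇒ s c q∣m = Sifted.odd s (∣-trans (∣m∣n⇒∣m+n (n∣m*n c) (∣m⇒∣m*n k (divides 3 refl))) q∣m)
  3∤⇒ : ∀ {q m} → Sifted M q m → ∀ c → c * 3 + 6 * k ∤ m
  3∤⇒ s c q∣m = Sifted.3∤ s (∣-trans (∣m∣n⇒∣m+n (n∣m*n c) (∣m⇒∣m*n k (divides 2 refl))) q∣m)
  telescope : P₂ * (12 + 18 * k) ≤ 1 * Q₂
  -- The cubic is the difference of the two sides, and its coefficients are all nonnegative.
  telescope = ≤-trans (m≤m+n _ (3588 + 7866 * k + 7884 * (k * k) + 2592 * (k * k * k))) (≤-reflexive (expand k))
    where
    expand : ∀ k → let Q₀ = 12 + 18 * suc k ; ν₁ = (10 + 6 * k) * (9 + 6 * k) ; ν₂ = (6 + 6 * k) * (5 + 6 * k) in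
      ((1 * suc ν₁ + Q₀) * suc ν₂ + Q₀ * ν₁) * (12 + 18 * k) + (3588 + 7866 * k + 7884 * (k * k) + 2592 * (k * k * k))
      ≡ 1 * (Q₀ * ν₁ * ν₂)
    expand = solve-∀

bound-coprime-30 : ∀ {m} → SquareFree m → 2 ∤ m → 3 ∤ m → 5 ∤ m → Bound m 1 12
bound-coprime-30 {m} sq 2∤m 3∤m 5∤m = bound-sifted m 0
  (s≤s (≤-trans (≤-trans (m≤m+n m 0) (m≤n*m (m + 0) 6)) (m≤n+m _ 6)))
  (sifted sq 2∤m 3∤m (∤⇒rough-suc 6∤m (∤⇒rough-suc 5∤m (∤⇒rough-suc 4∤m
    (∤⇒rough-suc 3∤m (∤⇒rough-suc 2∤m 2-rough))))) ≤-refl)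
  where
  4∤m : 4 ∤ m
  4∤m 4∣m = 2∤m (∣-trans (divides 2 refl) 4∣m)
  6∤m : 6 ∤ m
  6∤m 6∣m = 2∤m (∣-trans (divides 3 refl) 6∣m)

-- The primes 5 and 3

-- After division by N the last hypothesis reads 12 F (1 - w) ≤ w, where 1 - w is at least 1/4.
thin-bound : ∀ {F N w} → F ≤ N → 4 * w ≤ 3 * N → 12 * F * N ≤ (12 * F + 1 * N) * w → 3 * F ≤ w
thin-bound {F} {zero}  {w} z≤n _ _ = z≤n
thin-bound {F} {N@(suc _)} {w} _ 4w≤3N bad = *-cancelˡ-≤ (4 * N) (+-cancelˡ-≤ (36 * F * N) _ _ (begin
  36 * F * N + 4 * N * (3 * F)     ≡⟨ a F N ⟩
  4 * (12 * F * N)                 ≤⟨ *-monoʳ-≤ 4 bad ⟩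
  4 * ((12 * F + 1 * N) * w)       ≡⟨ b F N w ⟩
  12 * F * (4 * w) + 4 * N * w     ≤⟨ +-monoˡ-≤ (4 * N * w) (*-monoʳ-≤ (12 * F) 4w≤3N) ⟩
  12 * F * (3 * N) + 4 * N * w     ≡⟨ c F N w ⟩
  36 * F * N + 4 * N * w           ∎))
  where
  open ≤-Reasoning
  a : ∀ F N → 36 * F * N + 4 * N * (3 * F) ≡ 4 * (12 * F * N)
  a = solve-∀
  b : ∀ F N w → 4 * ((12 * F + 1 * N) * w) ≡ 12 * F * (4 * w) + 4 * N * w
  b = solve-∀
  c : ∀ F N w → 12 * F * (3 * N) + 4 * N * w ≡ 36 * F * N + 4 * N * w
  c = solve-∀

-- The last hypothesis is the conclusion of `runner-up` at p = 5, where n = 4. After division by N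
-- it gives 48 F ≤ 3 (12 F + 1).
runner-up-bound : ∀ {F N Δ} → F ≤ N → Δ ≤ 3 * N → 4 * (12 * F * N) ≤ (12 * F + 1 * N) * Δ → 4 * F ≤ N
runner-up-bound {F} {zero}      {Δ} z≤n _ _ = z≤n
runner-up-bound {F} {N@(suc _)} {Δ} _ Δ≤3N bad = *-cancelˡ-≤ (3 * N) (+-cancelˡ-≤ (36 * F * N) _ _ (begin
  36 * F * N + 3 * N * (4 * F)     ≡⟨ a F N ⟩
  4 * (12 * F * N)                 ≤⟨ bad ⟩
  (12 * F + 1 * N) * Δ             ≤⟨ *-monoʳ-≤ (12 * F + 1 * N) Δ≤3N ⟩
  (12 * F + 1 * N) * (3 * N)       ≡⟨ b F N ⟩
  36 * F * N + 3 * N * N           ∎))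
  where
  open ≤-Reasoning
  a : ∀ F N → 36 * F * N + 3 * N * (4 * F) ≡ 4 * (12 * F * N)
  a = solve-∀
  b : ∀ F N → (12 * F + 1 * N) * (3 * N) ≡ 36 * F * N + 3 * N * N
  b = solve-∀

prime[5] : Prime 5
prime[5] = from-yes (prime? 5)

module _ {N : ℕ} {F F′ H H′ : ℕ → ℕ}
         (F+F′ : ∀ r → F r + F′ r ≡ N) (H+H′ : ∀ r → H r + H′ r ≡ N)
         (F′-per : Periodic 5 F′) (H′-per : Periodic 5 H′) where

  private
    F≤N : ∀ r → F r ≤ N
    F≤N r = m+n≤o⇒m≤o (F r) (≤-reflexive (F+F′ r))

    H≤N : ∀ r → H r ≤ N
    H≤N r = m+n≤o⇒m≤o (H r) (≤-reflexive (H+H′ r))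

  -- The case where F is largest at 1, to which scaling ℤ/5 reduces.  If the conclusion fails, then
  -- F s ≤ N/4 for s = 2, 3, 4 although these values exceed F′ 1 + ∑ H′ in total.  Now either each s has its own
  -- t ≠ 0 with 1 + t + s = x, giving 3 F s ≤ F′ 1 + H′ t, or 1 + t + 1 = x gives 3N/4 ≤ F′ 1 + H′ t.
  mod-5-bound-max₁ : (∀ i → i < 4 → F (suc i) ≤ F 1) → ∀ x →
    (∀ r t s → 5 ∤ r → 5 ∤ t → 5 ∤ s → r + t + s ≋ x [ 5 ] → 12 * F s * N ≤ (12 * F s + 1 * N) * (F′ r + H′ t)) →
    ∑⁺ 4 F + ∑⁺ 4 H ≤ 5 * N
  mod-5-bound-max₁ max x bad = ≮⇒≥ contra
    where
    open ≤-Reasoning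
    ρ = F 2 + (F 3 + F 4)
    θ = F′ 1
    η = H′ 1 + (H′ 2 + (H′ 3 + H′ 4))
    Δ = ∑⁺ 4 F′ + ∑⁺ 4 H′
    total : ∀ {G G′ : ℕ → ℕ} → (∀ r → G r + G′ r ≡ N) → ∑⁺ 4 G + ∑⁺ 4 G′ ≡ 4 * N
    total {G} {G′} G+G′ = trans (sym (∑-+ 4 (G ∘ suc) (G′ ∘ suc))) (trans (∑-cong 4 (G+G′ ∘ suc)) (∑-const 4 N))
    contra : ¬ 5 * N < ∑⁺ 4 F + ∑⁺ 4 H
    contra 5N<∑ = cases (x % 5) (m%n<n x 5) (≋-% x)
      where
      -- If the conclusion fails, `F` and `H` take more than 5N of the total 8N.
      Δ≤3N : Δ ≤ 3 * N
      Δ≤3N = +-cancelˡ-≤ (5 * N) _ _ (begin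
        5 * N + Δ                       ≤⟨ +-monoˡ-≤ Δ (<⇒≤ 5N<∑) ⟩
        ∑⁺ 4 F + ∑⁺ 4 H + Δ             ≡⟨ a (∑⁺ 4 F) (∑⁺ 4 H) (∑⁺ 4 F′) (∑⁺ 4 H′) ⟩
        ∑⁺ 4 F + ∑⁺ 4 F′ + (∑⁺ 4 H + ∑⁺ 4 H′)   ≡⟨ cong₂ _+_ (total {F} F+F′) (total {H} H+H′) ⟩
        4 * N + 4 * N                   ≡⟨ b N ⟩
        5 * N + 3 * N                   ∎)
        where
        a : ∀ a b c d → a + b + (c + d) ≡ a + c + (b + d)
        a = solve-∀
        b : ∀ N → 4 * N + 4 * N ≡ 5 * N + 3 * N
        b = solve-∀
      -- This is the failed inequality after removing F 1 + θ = N and ∑ H + η = 4N.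
      θ+η<ρ : θ + η < ρ
      θ+η<ρ = +-cancelˡ-< (5 * N) _ _ (begin-strict
        5 * N + (θ + η)                        <⟨ +-monoˡ-< (θ + η) 5N<∑ ⟩
        ∑⁺ 4 F + ∑⁺ 4 H + (θ + η)              ≡⟨ a (F 1) (F 2) (F 3) (F 4) (∑⁺ 4 H) θ (H′ 1) (H′ 2) (H′ 3) (H′ 4) ⟩
        F 1 + θ + (∑⁺ 4 H + ∑⁺ 4 H′) + ρ       ≡⟨ cong₂ (λ u v → u + v + ρ) (F+F′ 1) (total {H} H+H′) ⟩
        5 * N + ρ                              ∎)
        where
        a : ∀ f₁ f₂ f₃ f₄ H θ a b c d → f₁ + (f₂ + (f₃ + (f₄ + 0))) + H + (θ + (a + (b + (c + d))))
                                       ≡ f₁ + θ + (H + (a + (b + (c + (d + 0))))) + (f₂ + (f₃ + f₄))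
        a = solve-∀
      -- `H` accounts for at most 4N, so more than N is left for four values of `F`, none above
      -- `F 1`.
      N<4F₁ : N < 4 * F 1
      N<4F₁ = +-cancelʳ-< (4 * N) _ _ (begin-strict
        N + 4 * N                     ≡⟨⟩
        5 * N                         <⟨ 5N<∑ ⟩
        ∑⁺ 4 F + ∑⁺ 4 H               ≤⟨ +-mono-≤ (∑-mono-< 4 max) (∑-mono-< 4 λ i _ → H≤N (suc i)) ⟩
        4 * F 1 + 4 * N               ∎)
      4F≤N : ∀ i → suc i < 4 → 4 * F (2 + i) ≤ N
      4F≤N i 1+i<4 = runner-up-bound (F≤N (2 + i)) Δ≤3N
        (runner-up prime[5] {F′} {H′} {F} N 12 1 x F′-per H′-per bad (unit∤ z<s (s<s z≤n)) (unit∤ z<s 1+i<4)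
          (distinct 1+i<4 z<s λ ()) (max (suc i) 1+i<4))
      small : ∀ i t → suc i < 4 → 5 ∤ t → 1 + t + (2 + i) ≋ x [ 5 ] → 3 * F (2 + i) ≤ θ + H′ t
      small i t 1+i<4 5∤t ≋x with ≤-total (4 * (θ + H′ t)) (3 * N)
      ... | inj₁ 4w≤3N = thin-bound (F≤N (2 + i)) 4w≤3N
                           (bad 1 t (2 + i) (unit∤ z<s (s<s z≤n)) 5∤t (unit∤ z<s 1+i<4) ≋x)
      -- A right side of at least 3N/4 suffices by itself, because F s is at most N/4.
      ... | inj₂ 3N≤4w = *-cancelˡ-≤ 4 (begin
          4 * (3 * F (2 + i))     ≡⟨ a (F (2 + i)) ⟩
          3 * (4 * F (2 + i))     ≤⟨ *-monoʳ-≤ 3 (4F≤N i 1+i<4) ⟩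
          3 * N                   ≤⟨ 3N≤4w ⟩
          4 * (θ + H′ t)          ∎)
        where
        a : ∀ f → 4 * (3 * f) ≡ 3 * (4 * f)
        a = solve-∀
      -- Otherwise `thin-bound` would apply at s = 1 and force F 1 below N/4.
      large : ∀ t → 5 ∤ t → 1 + t + 1 ≋ x [ 5 ] → 3 * N ≤ 4 * (θ + H′ t)
      large t 5∤t ≋x = ≮⇒≥ λ 4w<3N → <-irrefl refl (begin-strict
        3 * N                 <⟨ *-monoʳ-< 3 N<4F₁ ⟩
        3 * (4 * F 1)         ≡⟨ a (F 1) ⟩
        4 * (3 * F 1)         ≤⟨ *-monoʳ-≤ 4 (thin-bound (F≤N 1) (<⇒≤ 4w<3N)
                                    (bad 1 t 1 (unit∤ z<s (s<s z≤n)) 5∤t (unit∤ z<s (s<s z≤n)) ≋x)) ⟩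
        4 * (θ + H′ t)        <⟨ 4w<3N ⟩
        3 * N                 ∎)
        where
        a : ∀ f → 3 * (4 * f) ≡ 4 * (3 * f)
        a = solve-∀
      one-large : ∀ t → H′ t ≤ η → 5 ∤ t → 1 + t + 1 ≋ x [ 5 ] → ⊥
      one-large t H′t≤η 5∤t ≋x = <-irrefl refl (begin-strict
        3 * N                    ≤⟨ large t 5∤t ≋x ⟩
        4 * (θ + H′ t)           ≤⟨ *-monoʳ-≤ 4 (+-monoʳ-≤ θ H′t≤η) ⟩
        4 * (θ + η)              <⟨ *-monoʳ-< 4 θ+η<ρ ⟩
        4 * ρ                    ≡⟨ a (F 2) (F 3) (F 4) ⟩
        4 * F 2 + (4 * F 3 + 4 * F 4)    ≤⟨ +-mono-≤ (4F≤N 0 (s<s z<s)) (+-mono-≤ (4F≤N 1 (s<s (s<s z<s))) (4F≤N 2 ≤-refl)) ⟩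
        N + (N + N)              ≡⟨ b N ⟩
        3 * N                    ∎)
        where
        a : ∀ a b c → 4 * (a + (b + c)) ≡ 4 * a + (4 * b + 4 * c)
        a = solve-∀
        b : ∀ N → N + (N + N) ≡ 3 * N
        b = solve-∀
      three-small : ∀ t₂ t₃ t₄ → H′ t₂ + (H′ t₃ + H′ t₄) ≤ η → 3 * F 2 ≤ θ + H′ t₂ →
                    3 * F 3 ≤ θ + H′ t₃ → 3 * F 4 ≤ θ + H′ t₄ → ⊥
      three-small t₂ t₃ t₄ H′≤η F₂ F₃ F₄ = <-irrefl refl (begin-strict
        3 * (θ + η)                    <⟨ *-monoʳ-< 3 θ+η<ρ ⟩
        3 * ρ                          ≡⟨ a (F 2) (F 3) (F 4) ⟩
        3 * F 2 + (3 * F 3 + 3 * F 4)  ≤⟨ +-mono-≤ F₂ (+-mono-≤ F₃ F₄) ⟩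
        θ + H′ t₂ + (θ + H′ t₃ + (θ + H′ t₄))  ≡⟨ b θ (H′ t₂) (H′ t₃) (H′ t₄) ⟩
        3 * θ + 1 * (H′ t₂ + (H′ t₃ + H′ t₄))      ≤⟨ +-monoʳ-≤ (3 * θ) (*-mono-≤ {1} {3} (s≤s z≤n) H′≤η) ⟩
        3 * θ + 3 * η                  ≡⟨ *-distribˡ-+ 3 θ η ⟨
        3 * (θ + η)                    ∎)
        where
        a : ∀ a b c → 3 * (a + (b + c)) ≡ 3 * a + (3 * b + 3 * c)
        a = solve-∀
        b : ∀ θ a b c → θ + a + (θ + b + (θ + c)) ≡ 3 * θ + 1 * (a + (b + c))
        b = solve-∀
      u₁ = unit∤ {1} {4} z<s (s<s z≤n)
      u₂ = unit∤ {2} {4} z<s (s<s (s<s z≤n))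
      u₃ = unit∤ {3} {4} z<s (s<s (s<s (s<s z≤n)))
      u₄ = unit∤ {4} {4} z<s ≤-refl
      cases : ∀ y → y < 5 → y ≋ x [ 5 ] → ⊥
      -- For y = 0, 3, 4 the residue t = y - 2 is a unit, while some s among 2, 3, 4 would need t =
      -- 0 in 1 + t + s = y. For y = 1, 2 the residues t = y - 1 - s are nonzero and distinct.
      cases 0 _ y≋x = one-large 3 (m≤n⇒m≤o+n (H′ 1) (m≤n⇒m≤o+n (H′ 2) (m≤m+n _ _))) u₃ (≋-trans (0 , 1 , refl) y≋x)
      cases 1 _ y≋x = three-small 3 2 1
        (≤-trans (≤-reflexive (perm (H′ 3) (H′ 2) (H′ 1))) (+-monoʳ-≤ (H′ 1) (+-monoʳ-≤ (H′ 2) (m≤m+n _ _))))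
        (small 0 3 (s<s z<s) u₃ (≋-trans (0 , 1 , refl) y≋x))
        (small 1 2 (s<s (s<s z<s)) u₂ (≋-trans (0 , 1 , refl) y≋x))
        (small 2 1 ≤-refl u₁ (≋-trans (0 , 1 , refl) y≋x))
        where
        perm : ∀ a b c → a + (b + c) ≡ c + (b + a)
        perm = solve-∀
      cases 2 _ y≋x = three-small 4 3 2 (≤-trans (≤-reflexive (perm (H′ 4) (H′ 3) (H′ 2))) (m≤n+m _ (H′ 1)))
        (small 0 4 (s<s z<s) u₄ (≋-trans (0 , 1 , refl) y≋x))
        (small 1 3 (s<s (s<s z<s)) u₃ (≋-trans (0 , 1 , refl) y≋x))
        (small 2 2 ≤-refl u₂ (≋-trans (0 , 1 , refl) y≋x))
        where
        perm : ∀ a b c → a + (b + c) ≡ c + (b + a)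
        perm = solve-∀
      cases 3 _ y≋x = one-large 1 (m≤m+n _ _) u₁ y≋x
      cases 4 _ y≋x = one-large 2 (m≤n⇒m≤o+n (H′ 1) (m≤m+n _ _)) u₂ y≋x
      cases (suc (suc (suc (suc (suc _))))) (s≤s (s≤s (s≤s (s≤s (s≤s ()))))) _

periodic-scale : ∀ {X : Set} {p f} u → Periodic {X} p f → Periodic p (λ i → f (u * i))
periodic-scale {p = p} {f} u f-per i = trans (cong f (*-distribˡ-+ u i p)) (periodic-* f-per u (u * i))

-- Multiplication by a unit permutes the nonzero residues and carries the relation with target `x`
-- to one with another target, so the largest value of `F` may be assumed to lie at 1.
mod-5-bound : ∀ {N F F′ H H′} → (∀ r → F r + F′ r ≡ N) → (∀ r → H r + H′ r ≡ N) →
       Periodic 5 F → Periodic 5 F′ → Periodic 5 H → Periodic 5 H′ → ∀ x →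
       (∀ r t s → 5 ∤ r → 5 ∤ t → 5 ∤ s → r + t + s ≋ x [ 5 ] →
         12 * F s * N ≤ (12 * F s + 1 * N) * (F′ r + H′ t)) →
       ∑⁺ 4 F + ∑⁺ 4 H ≤ 5 * N
mod-5-bound {N} {F} F+F′ H+H′ F-per F′-per H-per H′-per x bad with argmax 3 (F ∘ suc)
... | i₀ , i₀<4 , max = subst (_≤ 5 * N) (cong₂ _+_ (∑⁺-scale u⊥5 F-per) (∑⁺-scale u⊥5 H-per))
    (mod-5-bound-max₁ (F+F′ ∘ (u *_)) (H+H′ ∘ (u *_)) (periodic-scale u F′-per) (periodic-scale u H′-per)
      (λ i i<4 → max-∤ (u * suc i) (u∤ (unit∤ z<s i<4))) x′
      λ r t s 5∤r 5∤t 5∤s ≋x′ → bad (u * r) (u * t) (u * s) (u∤ 5∤r) (u∤ 5∤t) (u∤ 5∤s)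
        (≋-trans (≋-reflexive (regroup u r t s)) (≋-trans (≋-*ˡ u ≋x′) ux′≋x)))
  where
  u = suc i₀
  u⊥5 = ∤⇒coprime prime[5] (unit∤ z<s i₀<4)
  x′ = proj₁ (solve-≋ u⊥5 x)
  ux′≋x = proj₂ (proj₂ (solve-≋ u⊥5 x))
  u∤ : ∀ {r} → 5 ∤ r → 5 ∤ u * r
  u∤ 5∤r 5∣ur = 5∤r (coprime-divisor (Coprime.sym u⊥5) 5∣ur)
  regroup : ∀ u r t s → u * r + u * t + u * s ≡ u * (r + t + s)
  regroup = solve-∀
  max-% : ∀ r y → y < 5 → y ≋ r [ 5 ] → 5 ∤ r → F y ≤ F (u * 1)
  max-% r zero    _       0≋r 5∤r = contradiction (∣-resp-≋ ∣-refl 0≋r (5 ∣0)) 5∤r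
  max-% r (suc i) (s<s i<4) _ _   = subst (λ k → F (suc i) ≤ F k) (sym (*-identityʳ u)) (max i i<4)
  max-∤ : ∀ r → 5 ∤ r → F r ≤ F (u * 1)
  max-∤ r 5∤r = subst (_≤ F (u * 1)) (periodic-≋ F-per (≋-% r)) (max-% r (r % 5) (m%n<n r 5) (≋-% r) 5∤r)

no-solution-swap : ∀ {m A B C x} → NoSolution m A B C x → NoSolution m A C B x
no-solution-swap noSol {a} {c} {b} a⊥m c⊥m b⊥m Aa Cc Bb a+c+b≋x = noSol a⊥m b⊥m c⊥m Aa Bb Cc
  (≋-trans (≋-reflexive (trans (+-assoc a b c) (trans (cong (a +_) (+-comm b c)) (sym (+-assoc a c b))))) a+c+b≋x)

-- The shape A + A + C is what fibres modulo 3 provide. One copy of A takes the third place in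
-- `Bound`, so that w collects the codensities of A and C. If 5 does not divide m, then a + c > 5/4
-- would give w < 3/4 and a > 1/4, against `thin-bound`; otherwise the fibres modulo 5 go into
-- `mod-5-bound`.
odd-coprime-3-bound : ∀ {m A C} → SquareFree m → 2 ∤ m → 3 ∤ m → ∀ x → Periodic m A → Periodic m C →
                      NoSolution m A A C x → 4 * (count m A + count m C) ≤ 5 * totient m
odd-coprime-3-bound {m} {A} {C} sq 2∤m 3∤m x A-per C-per noSol with 5 ∣? m
... | no 5∤m = ≮⇒≥ λ 5N<4[α+γ] →
  let open ≤-Reasoning
      4w<3N : 4 * w < 3 * N
      4w<3N = +-cancelʳ-< (5 * N) _ _ (begin-strict
        4 * w + 5 * N             <⟨ +-monoʳ-< (4 * w) 5N<4[α+γ] ⟩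
        4 * w + 4 * (α + γ)       ≡⟨ regroup α α′ γ γ′ ⟩
        4 * (α + α′ + (γ + γ′))   ≡⟨ cong₂ (λ a c → 4 * (a + c)) (count-complement m A) (count-complement m C) ⟩
        4 * (N + N)               ≡⟨ eight N ⟩
        3 * N + 5 * N             ∎)
      N<4α : N < 4 * α
      N<4α = +-cancelʳ-< (4 * N) _ _ (begin-strict
        5 * N                     <⟨ 5N<4[α+γ] ⟩
        4 * (α + γ)               ≡⟨ *-distribˡ-+ 4 α γ ⟩
        4 * α + 4 * γ             ≤⟨ +-monoʳ-≤ (4 * α) (*-monoʳ-≤ 4 (count≤totient m C)) ⟩
        4 * α + 4 * N             ∎)
      3α≤w : 3 * α ≤ w
      3α≤w = thin-bound (count≤totient m A) (<⇒≤ 4w<3N)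
        (bound-coprime-30 sq 2∤m 3∤m 5∤m x A-per C-per A-per (no-solution-swap {m} {A} {A} {C} noSol))
  in <-irrefl refl (begin-strict
       3 * N          <⟨ *-monoʳ-< 3 N<4α ⟩
       3 * (4 * α)    ≡⟨ twelve α ⟩
       4 * (3 * α)    ≤⟨ *-monoʳ-≤ 4 3α≤w ⟩
       4 * w          <⟨ 4w<3N ⟩
       3 * N          ∎)
  where
  N = totient m
  α = count m A
  α′ = count m (not ∘ A)
  γ = count m C
  γ′ = count m (not ∘ C)
  w = α′ + γ′
  regroup : ∀ α α′ γ γ′ → 4 * (α′ + γ′) + 4 * (α + γ) ≡ 4 * (α + α′ + (γ + γ′))
  regroup = solve-∀
  eight : ∀ N → 4 * (N + N) ≡ 3 * N + 5 * N
  eight = solve-∀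
  twelve : ∀ a → 3 * (4 * a) ≡ 4 * (3 * a)
  twelve = solve-∀
... | yes (divides k refl) = subst (λ m → 4 * (count m A + count m C) ≤ 5 * totient m) (*-comm 5 k)
  (cofactor-5 (subst (λ m → Periodic m A) (*-comm k 5) A-per) (subst (λ m → Periodic m C) (*-comm k 5) C-per)
                 (subst (λ m → NoSolution m A A C x) (*-comm k 5) noSol))
  where
  k∣m : k ∣ k * 5
  k∣m = m∣m*n 5
  k⊥5 = squarefree-cofactor prime[5] sq
  instance
    k≢0 : NonZero k
    k≢0 = odd⇒nonZero λ 2∣k → 2∤m (∣-trans 2∣k k∣m)
  open Fibres prime[5] k⊥5
  bound-k : Bound k 1 12
  bound-k = bound-coprime-30 (squarefree-∣ sq k∣m) (λ 2∣k → 2∤m (∣-trans 2∣k k∣m)) (λ 3∣k → 3∤m (∣-trans 3∣k k∣m))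
    λ 5∣k → contradiction (k⊥5 (5∣k , ∣-refl)) λ ()
  cofactor-5 : Periodic (5 * k) A → Periodic (5 * k) C → NoSolution (5 * k) A A C x →
                  4 * (count (5 * k) A + count (5 * k) C) ≤ 5 * totient (5 * k)
  cofactor-5 A-per C-per noSol = begin
    4 * (count (5 * k) A + count (5 * k) C)
      ≡⟨ cong₂ (λ a c → 4 * (a + c)) (count-fibres {A} A-per) (count-fibres {C} C-per) ⟩
    4 * (∑⁺ 4 F + ∑⁺ 4 H)
      ≤⟨ *-monoʳ-≤ 4 (mod-5-bound (λ j → count-complement k (fibre A j)) (λ j → count-complement k (fibre C j))
           (count-fibre-periodic {A} A-per) (count-fibre-periodic {not ∘ A} (cong not ∘ A-per))
           (count-fibre-periodic {C} C-per) (count-fibre-periodic {not ∘ C} (cong not ∘ C-per)) x₂ bad) ⟩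
    4 * (5 * totient k)                    ≡⟨ twenty (totient k) ⟩
    5 * (4 * totient k)                    ≡⟨ cong (5 *_) totient-* ⟨
    5 * totient (5 * k)                    ∎
    where
    open ≤-Reasoning
    twenty : ∀ N → 4 * (5 * N) ≡ 5 * (4 * N)
    twenty = solve-∀
    F H : ℕ → ℕ
    F j = count k (fibre A j)
    H j = count k (fibre C j)
    decomposed = fibre-no-solution {A} {A} {C} x noSol
    x₁ = proj₁ decomposed
    x₂ = proj₁ (proj₂ decomposed)
    bad : ∀ r t s → 5 ∤ r → 5 ∤ t → 5 ∤ s → r + t + s ≋ x₂ [ 5 ] →
          12 * F s * totient k ≤ (12 * F s + 1 * totient k) * (count k (not ∘ fibre A r) + count k (not ∘ fibre C t))
    bad r t s 5∤r 5∤t 5∤s r+t+s≋x₂ = bound-k x₁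
      (fibre-periodic {A} A-per r) (fibre-periodic {C} C-per t) (fibre-periodic {A} A-per s)
      (no-solution-swap {k} {fibre A r} {fibre A s} {fibre C t} (proj₂ (proj₂ decomposed) r s t 5∤r 5∤s 5∤t
        (≋-trans (≋-reflexive (trans (+-assoc r s t) (trans (cong (r +_) (+-comm s t)) (sym (+-assoc r t s))))) r+t+s≋x₂)))

-- When 3 divides m, the targets 1 and 2 modulo 3 are 1 + 1 + 2 and 2 + 2 + 1. So
-- `odd-coprime-3-bound` controls the sum of the two fibres, which is the whole of A.
odd-bound : ∀ {m A} → SquareFree m → 2 ∤ m → ∀ x → Periodic m A → NoSolution m A A A x →
            8 * count m A ≤ 5 * totient m
odd-bound {m} {A} sq 2∤m x A-per noSol with 3 ∣? m
... | no 3∤m = ≤-trans (≤-reflexive (eight (count m A))) (odd-coprime-3-bound {m} {A} {A} sq 2∤m 3∤m x A-per A-per noSol)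
  where
  eight : ∀ a → 8 * a ≡ 4 * (a + a)
  eight = solve-∀
... | yes (divides k refl) = subst (λ m → 8 * count m A ≤ 5 * totient m) (*-comm 3 k)
  (cofactor-3 (subst (λ m → Periodic m A) (*-comm k 3) A-per) (subst (λ m → NoSolution m A A A x) (*-comm k 3) noSol))
  where
  prime[3] : Prime 3
  prime[3] = from-yes (prime? 3)
  k∣m : k ∣ k * 3
  k∣m = m∣m*n 3
  k⊥3 = squarefree-cofactor prime[3] sq
  2∤k : 2 ∤ k
  2∤k 2∣k = 2∤m (∣-trans 2∣k k∣m)
  3∤k : 3 ∤ k
  3∤k 3∣k = contradiction (k⊥3 (3∣k , ∣-refl)) λ ()
  instance
    k≢0 : NonZero k
    k≢0 = odd⇒nonZero 2∤k
  open Fibres prime[3] k⊥3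
  cofactor-3 : Periodic (3 * k) A → NoSolution (3 * k) A A A x → 8 * count (3 * k) A ≤ 5 * totient (3 * k)
  cofactor-3 A-per noSol = begin
    8 * count (3 * k) A            ≡⟨ cong (8 *_) (count-fibres {A} A-per) ⟩
    8 * (F 1 + (F 2 + 0))      ≡⟨ regroup (F 1) (F 2) ⟩
    2 * (4 * (F 1 + F 2))      ≤⟨ *-monoʳ-≤ 2 (cases (x₂ % 3) (m%n<n x₂ 3) (≋-% x₂)) ⟩
    2 * (5 * N)                ≡⟨ ten N ⟩
    5 * (2 * N)                ≡⟨ cong (5 *_) totient-* ⟨
    5 * totient (3 * k)        ∎
    where
    open ≤-Reasoning
    N = totient k
    F : ℕ → ℕ
    F j = count k (fibre A j)
    regroup : ∀ a b → 8 * (a + (b + 0)) ≡ 2 * (4 * (a + b))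
    regroup = solve-∀
    ten : ∀ N → 2 * (5 * N) ≡ 5 * (2 * N)
    ten = solve-∀
    decomposed = fibre-no-solution {A} {A} {A} x noSol
    x₁ = proj₁ decomposed
    x₂ = proj₁ (proj₂ decomposed)
    u₁ = unit∤ {1} {2} z<s (s<s z≤n)
    u₂ = unit∤ {2} {2} z<s ≤-refl
    pair : ∀ r t → 3 ∤ r → 3 ∤ t → r + r + t ≋ x₂ [ 3 ] → 4 * (F r + F t) ≤ 5 * N
    pair r t 3∤r 3∤t ≋x₂ = odd-coprime-3-bound {k} {fibre A r} {fibre A t} (squarefree-∣ sq k∣m) 2∤k 3∤k x₁
      (fibre-periodic {A} A-per r) (fibre-periodic {A} A-per t) (proj₂ (proj₂ decomposed) r r t 3∤r 3∤r 3∤t ≋x₂)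
    double : ∀ a b → 2 * (4 * (a + b)) ≡ 4 * (a + a) + 4 * (b + b)
    double = solve-∀
    cases : ∀ y → y < 3 → y ≋ x₂ [ 3 ] → 4 * (F 1 + F 2) ≤ 5 * N
    -- With units, 0 is only 1 + 1 + 1 or 2 + 2 + 2; each of these bounds the density of one fibre
    -- by 5/8.
    cases 0 _ y≋x₂ = *-cancelˡ-≤ 2 (begin
      2 * (4 * (F 1 + F 2))                    ≡⟨ double (F 1) (F 2) ⟩
      4 * (F 1 + F 1) + 4 * (F 2 + F 2)        ≤⟨ +-mono-≤ (pair 1 1 u₁ u₁ (≋-trans (0 , 1 , refl) y≋x₂))
                                                           (pair 2 2 u₂ u₂ (≋-trans (0 , 2 , refl) y≋x₂)) ⟩
      5 * N + 5 * N                            ≡⟨ cong (5 * N +_) (+-identityʳ (5 * N)) ⟨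
      2 * (5 * N)                              ∎)
    cases 1 _ y≋x₂ = pair 1 2 u₁ u₂ (≋-trans (0 , 1 , refl) y≋x₂)
    cases 2 _ y≋x₂ = subst (λ s → 4 * s ≤ 5 * N) (+-comm (F 2) (F 1)) (pair 2 1 u₂ u₁ (≋-trans (0 , 1 , refl) y≋x₂))
    cases (suc (suc (suc _))) (s≤s (s≤s (s≤s ()))) _

-- From subsets of ℤ/m to periodic predicates

∣∣-tabulate : ∀ n (f : ℕ → Bool) → ∣ tabulate {n = n} (f ∘ toℕ) ∣ ≡ ∑ n (indicator ∘ f)
∣∣-tabulate zero    f = refl
∣∣-tabulate (suc n) f with f 0
... | true  = cong suc (∣∣-tabulate n (f ∘ suc))
... | false = ∣∣-tabulate n (f ∘ suc)

module _ {m : ℕ} .{{_ : NonZero m}} where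

  member : Subset m → ℕ → Bool
  member A a = lookup A (a mod m)

  mod-cong : ∀ {a b} → a ≋ b [ m ] → a mod m ≡ b mod m
  mod-cong {a} {b} a≋b = toℕ-injective (≋-<⇒≡ (≋-trans (toℕ-mod a) (≋-trans a≋b (≋-sym (toℕ-mod b)))) (toℕ<n _) (toℕ<n _))

  mod-toℕ : ∀ (i : Fin m) → toℕ i mod m ≡ i
  mod-toℕ i = toℕ-injective (≋-<⇒≡ (toℕ-mod (toℕ i)) (toℕ<n _) (toℕ<n i))

  member-periodic : ∀ A → Periodic m (member A)
  member-periodic A a = cong (lookup A) (mod-cong (0 , 1 , +-assoc a m 0))

  totient≡φ : totient m ≡ φ m
  totient≡φ = sym (trans (∣∣-tabulate m (λ a → does (coprime? a m)))
    (∑-cong m λ a → cong indicator (sym (∧-identityʳ (does (coprime? a m))))))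

  -- All members of A are units, so masking A by the coprimality test in `weight` leaves it
  -- unchanged.
  count-member : ∀ {A} → A ⊆ units m → count m (member A) ≡ ∣ A ∣
  count-member {A} A⊆units = sym (trans (cong ∣_∣ A≡) (∣∣-tabulate m (λ a → does (coprime? a m) ∧ member A a)))
    where
    unit-or-out : ∀ i → lookup A i ≡ does (coprime? (toℕ i) m) ∧ lookup A i
    unit-or-out i with lookup A i in Aᵢ
    ... | false = sym (∧-zeroʳ _)
    ... | true  = sym (trans (∧-identityʳ _)
                    (trans (sym (lookup∘tabulate _ i)) ([]=⇒lookup (A⊆units (lookup⇒[]= i A Aᵢ)))))
    A≡ : A ≡ tabulate (λ i → does (coprime? (toℕ i) m) ∧ member A (toℕ i))
    A≡ = trans (sym (tabulate∘lookup A)) (tabulate-cong λ i →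
      trans (unit-or-out i) (cong (λ j → does (coprime? (toℕ i) m) ∧ lookup A j) (sym (mod-toℕ i))))

  ⊕-≋ : ∀ (a b : Fin m) → toℕ (a ⊕ b) ≋ toℕ a + toℕ b [ m ]
  ⊕-≋ a b = toℕ-mod (toℕ a + toℕ b)

  -- Finite search decides the question, which makes the final argument by contradiction
  -- constructive.
  tripleSum? : ∀ A x → Dec (TripleSum A A A x)
  tripleSum? A x = any? λ a → any? λ b → any? λ c →
    (a ∈? A) ×-dec (b ∈? A) ×-dec (c ∈? A) ×-dec (x ≟ᶠ a ⊕ b ⊕ c)

  no-triple⇒no-solution : ∀ {A x} → ¬ TripleSum A A A x →
                          NoSolution m (member A) (member A) (member A) (toℕ x)
  no-triple⇒no-solution {A} {x} ∄ {a} {b} {c} _ _ _ Aa Ab Ac a+b+c≋x =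
    ∄ (a mod m , b mod m , c mod m , lookup⇒[]= _ A Aa , lookup⇒[]= _ A Ab , lookup⇒[]= _ A Ac ,
       toℕ-injective (≋-<⇒≡ (≋-sym (≋-trans (⊕-≋ (a mod m ⊕ b mod m) (c mod m))
         (≋-trans (≋-+ (≋-trans (⊕-≋ (a mod m) (b mod m)) (≋-+ (toℕ-mod a) (toℕ-mod b))) (toℕ-mod c)) a+b+c≋x)))
         (toℕ<n x) (toℕ<n _)))

corollary1p5 : (m : ℕ) .{{_ : NonZero m}} → Odd m → SquareFree m →
    (A : Subset m) → A ⊆ units m → 8 * ∣ A ∣ > 5 * φ m →
    TripleSum A A A ≐ U
corollary1p5 m odd sq A A⊆units 8∣A∣>5φ = (λ _ → tt) , λ {x} _ → decidable-stable (tripleSum? A x) λ ∄ →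
  <⇒≱ 8∣A∣>5φ (subst₂ (λ α N → 8 * α ≤ 5 * N) (count-member A⊆units) totient≡φ
    (odd-bound sq odd (toℕ x) (member-periodic A) (no-triple⇒no-solution ∄)))
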